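{- Let $d$ be a non-negative integer. Any lattice simplex of degree $\leq d$ and dimension $n \geq 4d-1$ is a lattice pyramid over an $(n-1)$-dimensional lattice simplex.
   Context: A lattice $M$ is a free abelian group of finite rank, and $M_{\mathbb{R}} = M \otimes_{\mathbb{Z}} \mathbb{R}$. A lattice polytope $P \subseteq M_{\mathbb{R}}$ is a polytope all of whose vertices lie in $M$; a lattice simplex is a lattice polytope that is a simplex. All lattice notions for $P$ are taken with respect to the affine lattice $\operatorname{aff}(P) \cap M$. For an $n$-dimensional lattice polytope $P$ one has $$\sum_{k \geq 0} |kP \cap M|\, t^k = \frac{h^*_0 + h^*_1 t + \cdots + h^*_n t^n}{(1-t)^{n+1}}$$ with non-negative integers $h^*_i$ (for $k=0$ the number of lattice points is $1$). The numerator is the $h^*$-polynomial of $P$, and the degree $\deg(P)$ of $P$ is the maximal $i$ with $h^*_i \neq 0$. Two lattice polytopes $P \subseteq M_{\mathbb{R}}$ and $P' \subseteq M'_{\mathbb{R}}$ are isomorphic if there is an affine lattice isomorphism $\operatorname{aff}(P)\cap M \cong \operatorname{aff}(P')\cap M'$ mapping the vertices of $P$ onto the vertices of $P'$. For a lattice polytope $B \subseteq \mathbb{R}^k$ with respect to $\mathbb{Z}^k$, the ($1$-fold) standard pyramid over $B$ is $\operatorname{conv}(\{0\} \cup (B \times \{1\})) \subseteq \mathbb{R}^{k+1}$, a lattice polytope with respect to $\mathbb{Z}^{k+1}$; the $l$-fold standard pyramid is obtained by iterating this $l$ times, and the $0$-fold standard pyramid over $B$ is $B$ itself. For lattice polytopes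 $Q \subseteq P$, we say that $P$ is a lattice pyramid over $Q$ if $P$ is isomorphic to the $(\dim(P)-\dim(Q))$-fold standard pyramid over some lattice polytope $B$ by an isomorphism mapping $Q$ onto the copy of $B$ in this standard pyramid. Convention: the empty set counts as a lattice simplex of dimension $-1$, and a single lattice point is a lattice pyramid over it. -}

module Defs where

open import Level using (Level; suc; _⊔_; 0ℓ)
open import Algebra.Bundles using (AbelianGroup)
open import Algebra.Morphism.Structures using (module GroupMorphisms)
import Algebra.Construct.Pointwise as Pointwise
import Algebra.Morphism.Construct.Identity as Identity
import Algebra.Properties.CommutativeMonoid.Sum as Sum
open import Data.Fin.Base as Fin using (Fin; toℕ)
open import Data.Integer.Base as ℤ using (ℤ; +_)
import Data.Integer.Properties as ℤ
open import Data.Nat.Base as ℕ using (ℕ; _∸_; _<_)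
open import Data.Product.Base using (Σ; ∃; _×_; _,_; proj₁)
open import Data.Rational.Base as ℚ using (ℚ; 0ℚ; 1ℚ)
import Data.Rational.Properties as ℚ
open import Data.Vec.Functional using (Vector; _∷_)
open import Function.Base using (id; _∘_)
open import Function.Bundles using (Inverse)
open import Relation.Binary.Bundles using (Setoid)
import Relation.Binary.Construct.On as On
open import Relation.Binary.PropositionalEquality
  using (_≡_; _≢_; _≗_; setoid)
open import Relation.Unary using (Pred; _∈_; _⊆_)

open Sum ℚ.+-0-commutativeMonoid using () renaming (sum to sumℚ)
open Sum ℤ.+-0-commutativeMonoid using () renaming (sum to sumℤ)

private
  variable
    c ℓ c′ ℓ′ : Level

------------------------------------------------------------------------
-- Lattices

ℤ^-abelianGroup : ℕ → AbelianGroup 0ℓ 0ℓ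
ℤ^-abelianGroup r = Pointwise.abelianGroup (Fin r) ℤ.+-0-abelianGroup

record Lattice (c ℓ : Level) : Set (suc (c ⊔ ℓ)) where
  field
    abelianGroup : AbelianGroup c ℓ
    rank         : ℕ

  open AbelianGroup abelianGroup public
    using (Carrier; _≈_; rawGroup)
    renaming (setoid to latticeSetoid)

  field
    coord     : Carrier → Vector ℤ rank
    coord-iso : GroupMorphisms.IsGroupIsomorphism
                  rawGroup (AbelianGroup.rawGroup (ℤ^-abelianGroup rank)) coord

ℤ^_ : ℕ → Lattice 0ℓ 0ℓ
ℤ^ r = record
  { abelianGroup = ℤ^-abelianGroup r
  ; rank         = r
  ; coord        = id
  ; coord-iso    = Identity.isGroupIsomorphism G.rawGroup G.refl
  }
  where module G = AbelianGroup (ℤ^-abelianGroup r)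

------------------------------------------------------------------------
-- The ambient vector space

-- M ⊗ ℚ, in the coordinates given by the chosen basis of M.  For a lattice
-- polytope rational scalars suffice in place of real ones: a rational point
-- that is a real affine (convex) combination of lattice points is also a
-- rational one, and lattice points are linearly independent over ℝ iff they
-- are so over ℚ.
Space : Lattice c ℓ → Set
Space M = Vector ℚ (Lattice.rank M)

module _ (M : Lattice c ℓ) where
  open Lattice M

  ι : Carrier → Space M
  ι x j = coord x j ℚ./ 1

  infixr 7 _•_
  _•_ : ℚ → Space M → Space M
  (a • y) j = a ℚ.* y j

  infixl 6 _⊕_
  _⊕_ : Space M → Space M → Space M
  (y ⊕ z) j = y j ℚ.+ z j

  combination : ∀ {m} → Vector ℚ m → Vector Carrier m → Space M
  combination a v j = sumℚ (λ i → (a i • ι (v i)) j)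

  AffineHull : ∀ {m} → Vector Carrier m → Pred (Space M) 0ℓ
  AffineHull v y = ∃ λ a → sumℚ a ≡ 1ℚ × combination a v ≗ y

  ConvexHull : ∀ {m} → Vector Carrier m → Pred (Space M) 0ℓ
  ConvexHull v y =
    ∃ λ a → (∀ i → 0ℚ ℚ.≤ a i) × sumℚ a ≡ 1ℚ × combination a v ≗ y

  AffinelyIndependent : ∀ {m} → Vector Carrier m → Set
  AffinelyIndependent v =
    ∀ a → sumℚ a ≡ 0ℚ → combination a v ≗ (λ _ → 0ℚ) → ∀ i → a i ≡ 0ℚ

  LatticePointsIn : Pred (Space M) 0ℓ → Setoid c ℓ
  LatticePointsIn S =
    On.setoid {B = Σ Carrier (λ x → ι x ∈ S)} latticeSetoid proj₁

------------------------------------------------------------------------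
-- Lattice polytopes

-- The polytope is the convex hull of the generators, which need not all be
-- vertices.  No generators are required: the empty set is included.
record LatticePolytope (M : Lattice c ℓ) : Set c where
  constructor conv
  field
    {size}     : ℕ
    generators : Vector (Lattice.Carrier M) size

module _ {M : Lattice c ℓ} where
  open Lattice M
  open LatticePolytope

  Points : LatticePolytope M → Pred (Space M) 0ℓ
  Points P = ConvexHull M (generators P)

  Aff : LatticePolytope M → Pred (Space M) 0ℓ
  Aff P = AffineHull M (generators P)

  AffineLattice : LatticePolytope M → Setoid c ℓ
  AffineLattice P = LatticePointsIn M (Aff P)

  IsVertex : LatticePolytope M → Carrier → Set
  IsVertex P x = ι M x ∈ Points P ×
    (∀ y z t → y ∈ Points P → z ∈ Points P → 0ℚ ℚ.< t → t ℚ.< 1ℚ →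
     _⊕_ M (_•_ M (1ℚ ℚ.- t) y) (_•_ M t z) ≗ ι M x → y ≗ z)

  -- m affinely independent points span a space of dimension m − 1; in
  -- particular the empty polytope has dimension −1.
  HasDimension : LatticePolytope M → ℤ → Set c
  HasDimension P δ = ∃ λ m → Σ (Vector Carrier m) λ u →
    AffinelyIndependent M u × (∀ i → ι M (u i) ∈ Points P) ×
    (∀ i → ι M (generators P i) ∈ AffineHull M u) ×
    δ ≡ + m ℤ.- + 1

  Dilate : ℕ → LatticePolytope M → Pred (Space M) 0ℓ
  Dilate k P y = ∃ λ z → z ∈ Points P × _•_ M (+ k ℚ./ 1) z ≗ y

  CountsLatticePoints : LatticePolytope M → ℕ → ℕ → Set (c ⊔ ℓ)
  CountsLatticePoints P k N =
    Inverse (LatticePointsIn M (Dilate k P)) (setoid (Fin N))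

-- A simplex with m vertices, hence of dimension m − 1; m = 0 is the empty
-- simplex.
record LatticeSimplex (M : Lattice c ℓ) (m : ℕ) : Set c where
  field
    vertices    : Vector (Lattice.Carrier M) m
    independent : AffinelyIndependent M vertices

  polytope : LatticePolytope M
  polytope = conv vertices

------------------------------------------------------------------------
-- h*-polynomial and degree

-- f stands for the formal power series Σ f k tᵏ.
PowerSeries : Set
PowerSeries = ℕ → ℤ

infixl 7 _⊛_
_⊛_ : PowerSeries → PowerSeries → PowerSeries
(f ⊛ g) k = sumℤ {ℕ.suc k} λ i → f (toℕ i) ℤ.* g (k ∸ toℕ i)

1-t : PowerSeries
1-t 0 = + 1
1-t 1 = ℤ.- + 1
1-t _ = + 0

[1-t]^_ : ℕ → PowerSeries
([1-t]^ 0) 0         = + 1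
([1-t]^ 0) (ℕ.suc _) = + 0
[1-t]^ (ℕ.suc m)     = 1-t ⊛ ([1-t]^ m)

module _ {M : Lattice c ℓ} where

  -- Here n must be the dimension of P.
  IsHStar : ℕ → LatticePolytope M → (ℕ → ℕ) → Set (c ⊔ ℓ)
  IsHStar n P h = Σ (ℕ → ℕ) λ L →
    L 0 ≡ 1 × (∀ k → CountsLatticePoints P (ℕ.suc k) (L (ℕ.suc k))) ×
    (∀ i → n < i → h i ≡ 0) ×
    [1-t]^ (ℕ.suc n) ⊛ (+_ ∘ L) ≗ +_ ∘ h

  HasDegree : ℕ → LatticePolytope M → ℕ → Set (c ⊔ ℓ)
  HasDegree n P e = ∃ λ h →
    IsHStar n P h × h e ≢ 0 × (∀ i → e < i → h i ≡ 0)

------------------------------------------------------------------------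
-- Isomorphisms and lattice pyramids

module _ {M : Lattice c ℓ} {M′ : Lattice c′ ℓ′} where
  private
    module M  = Lattice M
    module M′ = Lattice M′

  module _ (P : LatticePolytope M) (P′ : LatticePolytope M′) where
    private
      module A  = Setoid (AffineLattice P)
      module A′ = Setoid (AffineLattice P′)

    -- Preservation of all ℤ-linear combinations with coefficient sum 1.
    IsAffine : (A.Carrier → A′.Carrier) → Set c
    IsAffine f = ∀ {m} (a : Vector ℤ m) (x : Vector A.Carrier m) y →
      sumℤ a ≡ + 1 →
      (∀ j → sumℤ (λ i → a i ℤ.* M.coord (proj₁ (x i)) j)
             ≡ M.coord (proj₁ y) j) →
      (∀ j → sumℤ (λ i → a i ℤ.* M′.coord (proj₁ (f (x i))) j)
             ≡ M′.coord (proj₁ (f y)) j)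

    MapsVerticesOnto : (A.Carrier → A′.Carrier) →
                       LatticePolytope M → LatticePolytope M′ → Set (c ⊔ c′ ⊔ ℓ′)
    MapsVerticesOnto f R R′ =
      (∀ x → IsVertex R (proj₁ x) → IsVertex R′ (proj₁ (f x))) ×
      (∀ y → IsVertex R′ (proj₁ y) →
       ∃ λ x → IsVertex R (proj₁ x) × f x A′.≈ y)

    record Isomorphism : Set (c ⊔ ℓ ⊔ c′ ⊔ ℓ′) where
      field
        bijection : Inverse (AffineLattice P) (AffineLattice P′)
      open Inverse bijection public using (to)
      field
        affine    : IsAffine to
        vertices  : MapsVerticesOnto to P P′

-- The coordinate distinguished by the pyramid construction is put first
-- rather than last: B × {1} appears as {1} × B.
atHeightOne : ∀ {k} → LatticePolytope (ℤ^ k) → LatticePolytope (ℤ^ (ℕ.suc k))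
atHeightOne (conv b) = conv (λ i → + 1 ∷ b i)

pyramid : ∀ {k} → LatticePolytope (ℤ^ k) → LatticePolytope (ℤ^ (ℕ.suc k))
pyramid (conv b) = conv ((λ _ → + 0) ∷ (λ i → + 1 ∷ b i))

standardPyramid : ∀ {k} l → LatticePolytope (ℤ^ k) → LatticePolytope (ℤ^ (l ℕ.+ k))
standardPyramid 0         B = B
standardPyramid (ℕ.suc l) B = pyramid (standardPyramid l B)

copyOfBase : ∀ {k} l → LatticePolytope (ℤ^ k) → LatticePolytope (ℤ^ (l ℕ.+ k))
copyOfBase 0         B = B
copyOfBase (ℕ.suc l) B = atHeightOne (copyOfBase l B)

-- As Q and the copy of B are the convex hulls of their vertices, an affine map
-- takes Q onto the copy of B iff it takes vertices onto vertices.
record IsLatticePyramidOver {M : Lattice c ℓ} (P Q : LatticePolytope M)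
                            : Set (c ⊔ ℓ) where
  field
    Q⊆P       : Points Q ⊆ Points P
    dimP dimQ : ℤ
    dim-P     : HasDimension P dimP
    dim-Q     : HasDimension Q dimQ
    l         : ℕ
    l≡dimP-dimQ : + l ≡ dimP ℤ.- dimQ
    k         : ℕ
    B         : LatticePolytope (ℤ^ k)
    iso       : Isomorphism P (standardPyramid l B)
    Q↦B       : MapsVerticesOnto P (standardPyramid l B) (Isomorphism.to iso)
                                 Q (copyOfBase l B)

{-# OPTIONS --safe #-}

-- Represent a lattice point of the cone over P = conv(v₀,…,vₙ) by its
-- coefficients in the basis (vᵢ,1).  Requiring one more coefficient to be < 1
-- multiplies the generating function of the cone by 1−t: the points with
-- coefficient ≥ 1 are the translates by vᵢ of the points one level below.
-- Hence h*ₖ counts the points at height k with all coefficients in [0,1), and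
-- these heights are ≤ d.  Adding the fractional parts of g and −g shows that
-- every lattice point g has at most 2d non-integral coefficients.
--
-- If every coordinate i were non-integral for some lattice point gᵢ, then
-- toggling gᵢ shows that coordinate i is non-integral in at least half of the
-- subset sums of g₀,…,gₙ.  As the empty sum has none, some subset sum would
-- have more than (n+1)/2 ≥ 2d non-integral coordinates.  So some coordinate p
-- is integral at all lattice points, which makes v_p the apex of a lattice
-- pyramid.
module Submission where

open import Defs
open import Level using (Level; 0ℓ)
open import Algebra.Bundles using (AbelianGroup; CommutativeRing)
open import Algebra.Morphism.Structures using (module GroupMorphisms)
import Algebra.Properties.CommutativeMonoid.Sum as Sum
import Algebra.Properties.Group as GroupProperties
import Algebra.Properties.Semiring.Sum as SemiringSum
open import Data.Fin.Base as Fin using (Fin; zero; suc; toℕ; fromℕ<; punchIn; punchOut)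
open import Data.Fin.Properties as Fin using (toℕ-fromℕ<; toℕ-injective; punchIn-punchOut)
open import Data.Integer.Base as ℤ using (ℤ; +_; -[1+_])
import Data.Integer.DivMod as ℤ
import Data.Integer.Properties as ℤ
open import Data.Integer.Solver using () renaming (module +-*-Solver to ℤ-Solver)
open import Data.List.Base as List using (List; []; _∷_; length; filter; map; allFin)
open import Data.List.Membership.Propositional using () renaming (_∈_ to _∈ₗ_)
open import Data.List.Membership.Propositional.Properties
  using (∈-filter⁺; ∈-filter⁻; ∈-map⁺; ∈-map⁻; ∈-allFin)
open import Data.List.Membership.Propositional.Properties.WithK using (unique∧set⇒bag)
open import Data.List.Properties using (length-map; length-tabulate; filter-all; filter-none)
open import Data.List.Relation.Binary.BagAndSetEquality using (∼bag⇒↭)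
open import Data.List.Relation.Binary.Permutation.Propositional.Properties using (↭-length)
open import Data.List.Relation.Unary.All as All using (All; []; _∷_)
import Data.List.Relation.Unary.All.Properties as All
open import Data.List.Relation.Unary.Any using (Any; here; there)
import Data.List.Relation.Unary.Any.Properties as Any
import Data.List.Relation.Unary.Unique.Propositional.Properties as Unique
open import Data.Nat.Base as ℕ using (ℕ; suc; _+_; _*_; _∸_; _^_; _≤_)
import Data.Nat.Coprimality as Coprime
import Data.Nat.Properties as ℕ
open import Data.Nat.Solver using () renaming (module +-*-Solver to ℕ-Solver)
open import Data.Product.Base using (∃; Σ; _×_; _,_; proj₁; proj₂)
open import Data.Rational.Base as ℚ using (ℚ; mkℚ; 0ℚ; 1ℚ; *≤*; *<*)
import Data.Rational.Properties as ℚ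
open import Data.Rational.Solver using () renaming (module +-*-Solver to ℚ-Solver)
open import Data.Sum.Base using (_⊎_; inj₁; inj₂)
open import Data.Vec.Functional using (Vector; head; tail; removeAt; insertAt)
  renaming (_∷_ to _∷ᵛ_)
open import Data.Vec.Functional.Properties using (insertAt-lookup; removeAt-insertAt)
open import Function.Base using (_∘_)
open import Function.Bundles using (Inverse; mk⇔)
open import Relation.Binary.Bundles using (Setoid)
open import Relation.Binary.PropositionalEquality
open import Relation.Nullary using (¬_; Dec; yes; no; contradiction; _×-dec_; _→-dec_)
open import Relation.Unary using (Pred; Decidable; _∈_; _⊆_)

open GroupProperties ℚ.+-0-group using ()
  renaming (∙-cancelʳ to +-cancelʳ; x∙y⁻¹≈ε⇒x≈y to x-y≡0⇒x≡y)
open SemiringSum (CommutativeRing.semiring ℚ.+-*-commutativeRing)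
  using (*-distribˡ-sum; *-distribʳ-sum)

module Σℚ = Sum ℚ.+-0-commutativeMonoid
module Σℤ = Sum ℤ.+-0-commutativeMonoid
module Σℕ = Sum ℕ.+-0-commutativeMonoid

-- Integers inside the rationals, floors and fractional parts.

<⇒≱ : ∀ {p q} → p ℚ.< q → ¬ (q ℚ.≤ p)
<⇒≱ p<q q≤p = ℚ.<-irrefl refl (ℚ.<-≤-trans p<q q≤p)

fromℤ : ℤ → ℚ
fromℤ z = z ℚ./ 1

-- `z / 1` normalises by a gcd and is stuck for a variable z. Rewriting with this equation exposes
-- numerator and denominator, after which order and multiplication compute.
fromℤ-mkℚ : ∀ z → fromℤ z ≡ mkℚ z 0 (Coprime.sym (Coprime.1-coprimeTo ℤ.∣ z ∣))
fromℤ-mkℚ z = ℚ.↥p/↧p≡p (mkℚ z 0 _)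

fromℤ-+ : ∀ a b → fromℤ (a ℤ.+ b) ≡ fromℤ a ℚ.+ fromℤ b
fromℤ-+ a b rewrite fromℤ-mkℚ a | fromℤ-mkℚ b =
  cong fromℤ (sym (cong₂ ℤ._+_ (ℤ.*-identityʳ a) (ℤ.*-identityʳ b)))

fromℤ-* : ∀ a b → fromℤ (a ℤ.* b) ≡ fromℤ a ℚ.* fromℤ b
fromℤ-* a b rewrite fromℤ-mkℚ a | fromℤ-mkℚ b = refl

fromℤ-neg : ∀ a → fromℤ (ℤ.- a) ≡ ℚ.- fromℤ a
fromℤ-neg a = begin
  x                             ≡⟨ solve 2 (λ x y → x := (x :+ y) :- y) refl x (fromℤ a) ⟩
  (x ℚ.+ fromℤ a) ℚ.- fromℤ a
    ≡⟨ cong (ℚ._- fromℤ a) (trans (sym (fromℤ-+ (ℤ.- a) a)) (cong fromℤ (ℤ.+-inverseˡ a))) ⟩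
  0ℚ ℚ.- fromℤ a                ≡⟨ ℚ.+-identityˡ _ ⟩
  ℚ.- fromℤ a                   ∎
  where
  open ≡-Reasoning
  open ℚ-Solver
  x = fromℤ (ℤ.- a)

fromℤ-mono-≤ : ∀ a b → a ℤ.≤ b → fromℤ a ℚ.≤ fromℤ b
fromℤ-mono-≤ a b a≤b rewrite fromℤ-mkℚ a | fromℤ-mkℚ b =
  *≤* (subst₂ ℤ._≤_ (sym (ℤ.*-identityʳ a)) (sym (ℤ.*-identityʳ b)) a≤b)

fromℤ-cancel-≤ : ∀ a b → fromℤ a ℚ.≤ fromℤ b → a ℤ.≤ b
fromℤ-cancel-≤ a b a≤b rewrite fromℤ-mkℚ a | fromℤ-mkℚ b =
  subst₂ ℤ._≤_ (ℤ.*-identityʳ a) (ℤ.*-identityʳ b) (ℚ.drop-*≤* a≤b)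

fromℤ-injective : ∀ a b → fromℤ a ≡ fromℤ b → a ≡ b
fromℤ-injective a b a≡b =
  ℤ.≤-antisym
    (fromℤ-cancel-≤ a b (ℚ.≤-reflexive a≡b)) (fromℤ-cancel-≤ b a (ℚ.≤-reflexive (sym a≡b)))

fromℤ-sum : ∀ {n} (f : Vector ℤ n) → fromℤ (Σℤ.sum f) ≡ Σℚ.sum (fromℤ ∘ f)
fromℤ-sum {0}     f = refl
fromℤ-sum {suc n} f =
  trans (fromℤ-+ (f zero) (Σℤ.sum (f ∘ suc))) (cong (fromℤ (f zero) ℚ.+_) (fromℤ-sum (f ∘ suc)))

record Integral (q : ℚ) : Set where
  constructor integral
  field
    integer  : ℤ
    equality : q ≡ fromℤ integer

open Integral

integral-fromℤ : ∀ z → Integral (fromℤ z)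
integral-fromℤ z = integral z refl

integral-+ : ∀ {p q} → Integral p → Integral q → Integral (p ℚ.+ q)
integral-+ (integral a refl) (integral b refl) = integral (a ℤ.+ b) (sym (fromℤ-+ a b))

integral-neg : ∀ {p} → Integral p → Integral (ℚ.- p)
integral-neg (integral a refl) = integral (ℤ.- a) (sym (fromℤ-neg a))

integral-* : ∀ {p q} → Integral p → Integral q → Integral (p ℚ.* q)
integral-* (integral a refl) (integral b refl) = integral (a ℤ.* b) (sym (fromℤ-* a b))

integral-sum : ∀ {n} (f : Vector ℚ n) → (∀ i → Integral (f i)) → Integral (Σℚ.sum f)
integral-sum {0}     f hf = integral (+ 0) refl
integral-sum {suc n} f hf = integral-+ (hf zero) (integral-sum (f ∘ suc) (hf ∘ suc))

floor≤ : ∀ q → fromℤ (ℚ.floor q) ℚ.≤ q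
floor≤ q@record{} rewrite fromℤ-mkℚ (ℚ.floor q) =
  *≤* (subst (ℚ.floor q ℤ.* ℚ.↧ q ℤ.≤_) (sym (ℤ.*-identityʳ (ℚ.↥ q)))
    (ℤ.[n/d]*d≤n (ℚ.↥ q) (ℚ.↧ q)))

<floor+1 : ∀ q → q ℚ.< fromℤ (ℤ.suc (ℚ.floor q))
<floor+1 q@record{} rewrite fromℤ-mkℚ (ℤ.suc (ℚ.floor q)) =
  *<* (subst₂ ℤ._<_ (sym (ℤ.*-identityʳ (ℚ.↥ q)))
    (cong (λ z → ℤ.suc z ℤ.* ℚ.↧ q) (sym (ℤ.div-pos-is-/ℕ (ℚ.↥ q) (ℚ.↧ₙ q))))
    (ℤ.n<s[n/ℕd]*d (ℚ.↥ q) (ℚ.↧ₙ q)))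

frac : ℚ → ℚ
frac q = q ℚ.- fromℤ (ℚ.floor q)

0≤frac : ∀ q → 0ℚ ℚ.≤ frac q
0≤frac q = subst (ℚ._≤ frac q) (ℚ.+-inverseʳ (fromℤ (ℚ.floor q)))
  (ℚ.+-monoˡ-≤ (ℚ.- fromℤ (ℚ.floor q)) (floor≤ q))

frac<1 : ∀ q → frac q ℚ.< 1ℚ
frac<1 q = subst (frac q ℚ.<_) eq (ℚ.+-monoˡ-< (ℚ.- f) (<floor+1 q))
  where
  open ℚ-Solver
  f = fromℤ (ℚ.floor q)
  eq : fromℤ (ℤ.suc (ℚ.floor q)) ℚ.- f ≡ 1ℚ
  eq = trans (cong (ℚ._- f) (fromℤ-+ (+ 1) (ℚ.floor q)))
    (solve 2 (λ o f → (o :+ f) :- f := o) refl 1ℚ f)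

q≡frac+floor : ∀ q → q ≡ frac q ℚ.+ fromℤ (ℚ.floor q)
q≡frac+floor q = solve 2 (λ q f → q := (q :- f) :+ f) refl q (fromℤ (ℚ.floor q))
  where open ℚ-Solver

integral-frac⁻ : ∀ {q} → Integral (frac q) → Integral q
integral-frac⁻ {q} h =
  subst Integral (sym (q≡frac+floor q)) (integral-+ h (integral-fromℤ (ℚ.floor q)))

integral-frac⁺ : ∀ {q} → Integral q → Integral (frac q)
integral-frac⁺ {q} h = integral-+ h (integral-neg (integral-fromℤ (ℚ.floor q)))

integral∧unit⇒0 : ∀ {q} → 0ℚ ℚ.≤ q → q ℚ.< 1ℚ → Integral q → q ≡ 0ℚ
integral∧unit⇒0 0≤q q<1 (integral z refl) = cong fromℤ
  (ℤ.≤-antisym (ℤ.≮⇒≥ (λ 0<z → <⇒≱ q<1 (fromℤ-mono-≤ (+ 1) z (ℤ.i<j⇒suc[i]≤j 0<z))))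
    (fromℤ-cancel-≤ (+ 0) z 0≤q))

-- A fractional part lies in [0,1), where 0 is the only integer, so integrality reduces to a
-- decidable equation.
integral? : ∀ q → Dec (Integral q)
integral? q with frac q ℚ.≟ 0ℚ
... | yes eq = yes (integral-frac⁻ (integral (+ 0) eq))
... | no neq = no λ h → neq (integral∧unit⇒0 (0≤frac q) (frac<1 q) (integral-frac⁺ h))

nonIntegral : ℚ → ℕ
nonIntegral q with integral? q
... | yes _ = 0
... | no _  = 1

-- For integral q both fractional parts vanish. Otherwise the sum is the integer -(⌊q⌋ + ⌊-q⌋), and
-- it lies strictly between 0 and 2.
frac+frac- : ∀ q → frac q ℚ.+ frac (ℚ.- q) ≡ fromℤ (+ nonIntegral q)
frac+frac- q with integral? q
... | yes h = cong₂ ℚ._+_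
  (integral∧unit⇒0 (0≤frac q) (frac<1 q) (integral-frac⁺ h))
  (integral∧unit⇒0 (0≤frac (ℚ.- q)) (frac<1 (ℚ.- q)) (integral-frac⁺ (integral-neg h)))
... | no ¬h = trans (equality sumInt) (cong fromℤ (ℤ.≤-antisym s≤1 1≤s))
  where
  open ℚ-Solver
  s = frac q ℚ.+ frac (ℚ.- q)
  sumInt : Integral s
  sumInt = subst Integral
    (solve 3 (λ q f g → :- (f :+ g) := (q :- f) :+ (:- q :- g)) refl q
      (fromℤ (ℚ.floor q)) (fromℤ (ℚ.floor (ℚ.- q))))
    (integral-neg (integral-+ (integral-fromℤ (ℚ.floor q)) (integral-fromℤ (ℚ.floor (ℚ.- q)))))
  z = integer sumInt
  s<2 : s ℚ.< fromℤ (+ 2)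
  s<2 = ℚ.+-mono-< (frac<1 q) (frac<1 (ℚ.- q))
  s≤1 : z ℤ.≤ + 1
  s≤1 = ℤ.≮⇒≥ λ 1<z → <⇒≱ s<2
    (subst (fromℤ (+ 2) ℚ.≤_) (sym (equality sumInt)) (fromℤ-mono-≤ (+ 2) z (ℤ.i<j⇒suc[i]≤j 1<z)))
  frac≢0 : frac q ≢ 0ℚ
  frac≢0 eq = ¬h (integral-frac⁻ (integral (+ 0) eq))
  0<frac : 0ℚ ℚ.< frac q
  0<frac = ℚ.≰⇒> λ le → frac≢0 (ℚ.≤-antisym le (0≤frac q))
  1≤s : + 1 ℤ.≤ z
  1≤s = ℤ.i<j⇒suc[i]≤j (ℤ.≰⇒> λ z≤0 → <⇒≱ (ℚ.+-mono-<-≤ 0<frac (0≤frac (ℚ.- q)))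
          (subst (ℚ._≤ 0ℚ) (sym (equality sumInt)) (fromℤ-mono-≤ z (+ 0) z≤0)))

-- Two integers would have an integral difference. This is the base case of the toggling argument.
nonIntegral-separated : ∀ {p q} → ¬ Integral (q ℚ.- p) → 1 ℕ.≤ nonIntegral p ℕ.+ nonIntegral q
nonIntegral-separated {p} {q} ¬h with integral? p | integral? q
... | yes hp | yes hq = contradiction (integral-+ hq (integral-neg hp)) ¬h
... | yes _  | no _   = ℕ.s≤s ℕ.z≤n
... | no _   | yes _  = ℕ.s≤s ℕ.z≤n
... | no _   | no _   = ℕ.s≤s ℕ.z≤n

-- Finite sums and unit vectors.

sum-nonNeg : ∀ {n} (f : Vector ℚ n) → (∀ i → 0ℚ ℚ.≤ f i) → 0ℚ ℚ.≤ Σℚ.sum f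
sum-nonNeg {0}     f hf = ℚ.≤-refl
sum-nonNeg {suc n} f hf = ℚ.+-mono-≤ (hf zero) (sum-nonNeg (f ∘ suc) (hf ∘ suc))

term≤sum : ∀ {n} (f : Vector ℚ n) → (∀ i → 0ℚ ℚ.≤ f i) → ∀ i → f i ℚ.≤ Σℚ.sum f
term≤sum {suc n} f hf i = subst₂ ℚ._≤_ (ℚ.+-identityʳ (f i)) (sym (Σℚ.sum-remove {i = i} f))
  (ℚ.+-monoʳ-≤ (f i) (sum-nonNeg (removeAt f i) (hf ∘ punchIn i)))

sum-mono-≤ : ∀ {n} (f g : Vector ℕ n) → (∀ i → f i ℕ.≤ g i) → Σℕ.sum f ℕ.≤ Σℕ.sum g
sum-mono-≤ {0}     f g h = ℕ.z≤n
sum-mono-≤ {suc n} f g h = ℕ.+-mono-≤ (h zero) (sum-mono-≤ (f ∘ suc) (g ∘ suc) (h ∘ suc))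

sum-const : ∀ n c → Σℕ.sum {n} (λ _ → c) ≡ n ℕ.* c
sum-const 0       c = refl
sum-const (suc n) c = cong (c ℕ.+_) (sum-const n c)

pos-sum : ∀ {n} (f : Vector ℕ n) → + Σℕ.sum f ≡ Σℤ.sum (+_ ∘ f)
pos-sum {0}     f = refl
pos-sum {suc n} f = cong (ℤ._+_ (+ f zero)) (pos-sum (f ∘ suc))

sum-neg : ∀ {n} (f : Vector ℚ n) → Σℚ.sum (ℚ.-_ ∘ f) ≡ ℚ.- Σℚ.sum f
sum-neg {0}     f = refl
sum-neg {suc n} f =
  trans (cong (ℚ.- f zero ℚ.+_) (sum-neg (f ∘ suc))) (sym (ℚ.neg-distrib-+ (f zero) _))

unit : ∀ {n} → Fin n → Vector ℚ n
unit zero    zero    = 1ℚ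
unit zero    (suc j) = 0ℚ
unit (suc i) zero    = 0ℚ
unit (suc i) (suc j) = unit i j

unit-diagonal : ∀ {n} (i : Fin n) → unit i i ≡ 1ℚ
unit-diagonal zero    = refl
unit-diagonal (suc i) = unit-diagonal i

unit-off-diagonal : ∀ {n} {i j : Fin n} → i ≢ j → unit i j ≡ 0ℚ
unit-off-diagonal {i = zero}  {zero}  i≢j = contradiction refl i≢j
unit-off-diagonal {i = zero}  {suc j} i≢j = refl
unit-off-diagonal {i = suc i} {zero}  i≢j = refl
unit-off-diagonal {i = suc i} {suc j} i≢j = unit-off-diagonal (i≢j ∘ cong suc)

-- Ensures that a shift in direction i leaves alone the earlier coefficients, on which the bound < 1
-- has already been imposed.
unit-below : ∀ {n} (i j : Fin n) → toℕ j ℕ.< toℕ i → unit i j ≡ 0ℚ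
unit-below i j j<i = unit-off-diagonal {i = i} {j} λ { refl → ℕ.<-irrefl refl j<i }

0≤unit : ∀ {n} (i j : Fin n) → 0ℚ ℚ.≤ unit i j
0≤unit zero    zero    = ℚ.nonNegative⁻¹ 1ℚ
0≤unit zero    (suc j) = ℚ.≤-refl
0≤unit (suc i) zero    = ℚ.≤-refl
0≤unit (suc i) (suc j) = 0≤unit i j

integral-unit : ∀ {n} (i j : Fin n) → Integral (unit i j)
integral-unit zero    zero    = integral (+ 1) refl
integral-unit zero    (suc j) = integral (+ 0) refl
integral-unit (suc i) zero    = integral (+ 0) refl
integral-unit (suc i) (suc j) = integral-unit i j

sum-zeroˡ : ∀ {n} (f : Vector ℚ n) → Σℚ.sum (λ j → 0ℚ ℚ.* f j) ≡ 0ℚ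
sum-zeroˡ f = trans (sym (*-distribˡ-sum 0ℚ f)) (ℚ.*-zeroˡ (Σℚ.sum f))

sum-unit* : ∀ {n} (i : Fin n) (f : Vector ℚ n) → Σℚ.sum (λ j → unit i j ℚ.* f j) ≡ f i
sum-unit* zero    f =
  trans (cong₂ ℚ._+_ (ℚ.*-identityˡ (f zero)) (sum-zeroˡ (f ∘ suc))) (ℚ.+-identityʳ _)
sum-unit* (suc i) f =
  trans (cong₂ ℚ._+_ (ℚ.*-zeroˡ (f zero)) (sum-unit* i (f ∘ suc))) (ℚ.+-identityˡ _)

sum-unit : ∀ {n} (i : Fin n) → Σℚ.sum (unit i) ≡ 1ℚ
sum-unit i = trans (Σℚ.sum-cong-≗ (λ j → sym (ℚ.*-identityʳ (unit i j)))) (sum-unit* i (λ _ → 1ℚ))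

-- Multiplication of power series by 1-t.

⊛-zero : ∀ f g → (f ⊛ g) 0 ≡ f 0 ℤ.* g 0
⊛-zero f g = ℤ.+-identityʳ _

1-t⊛-zero : ∀ f → (1-t ⊛ f) 0 ≡ f 0
1-t⊛-zero f = trans (⊛-zero 1-t f) (ℤ.*-identityˡ (f 0))

sum-zeros : ∀ n (g : Vector ℤ n) → Σℤ.sum (λ i → + 0 ℤ.* g i) ≡ + 0
sum-zeros 0       g = refl
sum-zeros (suc n) g = trans (ℤ.+-identityˡ _) (sum-zeros n (g ∘ suc))

1-t⊛-suc : ∀ f k → (1-t ⊛ f) (suc k) ≡ f (suc k) ℤ.- f k
1-t⊛-suc f k = trans
  (cong (λ s → + 1 ℤ.* f (suc k) ℤ.+ ((ℤ.- + 1) ℤ.* f k ℤ.+ s))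
    (sum-zeros k (λ i → f (k ∸ suc (toℕ i)))))
  (solve 2 (λ x y → con (+ 1) :* x :+ (con (ℤ.- + 1) :* y :+ con (+ 0)) := x :- y) refl
    (f (suc k)) (f k))
  where open ℤ-Solver

-- The case of associativity that peels one factor off `[1-t]^ (suc j)`. Multiplying by 1-t takes
-- differences of consecutive coefficients, and convolution is linear in its first argument.
1-t⊛-assoc : ∀ f g → ((1-t ⊛ f) ⊛ g) ≗ (1-t ⊛ (f ⊛ g))
1-t⊛-assoc f g 0 = begin
  ((1-t ⊛ f) ⊛ g) 0    ≡⟨ ⊛-zero (1-t ⊛ f) g ⟩
  (1-t ⊛ f) 0 ℤ.* g 0  ≡⟨ cong (ℤ._* g 0) (1-t⊛-zero f) ⟩
  f 0 ℤ.* g 0          ≡⟨ ⊛-zero f g ⟨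
  (f ⊛ g) 0            ≡⟨ 1-t⊛-zero (f ⊛ g) ⟨
  (1-t ⊛ (f ⊛ g)) 0    ∎
  where open ≡-Reasoning
1-t⊛-assoc f g (suc k) = begin
  (1-t ⊛ f) 0 ℤ.* g (suc k) ℤ.+ Σℤ.sum {suc k} (λ i → (1-t ⊛ f) (suc (toℕ i)) ℤ.* g (k ∸ toℕ i))
    ≡⟨ cong₂ (λ x s → x ℤ.* g (suc k) ℤ.+ s) (1-t⊛-zero f)
         (Σℤ.sum-cong-≗ {suc k} λ i → cong (ℤ._* g (k ∸ toℕ i)) (1-t⊛-suc f (toℕ i))) ⟩
  f 0 ℤ.* g (suc k) ℤ.+ Σℤ.sum {suc k} (λ i → (f (suc (toℕ i)) ℤ.- f (toℕ i)) ℤ.* g (k ∸ toℕ i))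
    ≡⟨ cong (λ s → f 0 ℤ.* g (suc k) ℤ.+ s)
      (difference (suc k) (λ i → f (suc (toℕ i))) (λ i → f (toℕ i)) (λ i → g (k ∸ toℕ i))) ⟩
  f 0 ℤ.* g (suc k) ℤ.+ (Σℤ.sum {suc k} (λ i → f (suc (toℕ i)) ℤ.* g (k ∸ toℕ i)) ℤ.- (f ⊛ g) k)
    -- The leading term and the sum over shifted indices together are `(f ⊛ g) (suc k)` by
    -- definition.
    ≡⟨ ℤ.+-assoc (f 0 ℤ.* g (suc k)) _ (ℤ.- (f ⊛ g) k) ⟨
  (f ⊛ g) (suc k) ℤ.- (f ⊛ g) k
    ≡⟨ 1-t⊛-suc (f ⊛ g) k ⟨
  (1-t ⊛ (f ⊛ g)) (suc k) ∎
  where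
  open ≡-Reasoning
  difference : ∀ n (a b c : Vector ℤ n) →
    Σℤ.sum (λ i → (a i ℤ.- b i) ℤ.* c i) ≡ Σℤ.sum (λ i → a i ℤ.* c i) ℤ.- Σℤ.sum (λ i → b i ℤ.* c i)
  difference 0       a b c = refl
  difference (suc n) a b c = trans (cong (λ s → (a zero ℤ.- b zero) ℤ.* c zero ℤ.+ s)
    (difference n (a ∘ suc) (b ∘ suc) (c ∘ suc)))
    (solve 5 (λ a b c s t → (a :- b) :* c :+ (s :- t) := (a :* c :+ s) :- (b :* c :+ t)) refl
      (a zero) (b zero) (c zero) _ _)
    where open ℤ-Solver

[1-t]^0⊛ : ∀ f → ([1-t]^ 0 ⊛ f) ≗ f
[1-t]^0⊛ f 0       = trans (⊛-zero ([1-t]^ 0) f) (ℤ.*-identityˡ (f 0))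
[1-t]^0⊛ f (suc k) = trans (cong₂ ℤ._+_ (ℤ.*-identityˡ (f (suc k)))
  (sum-zeros (suc k) (λ i → f (k ∸ toℕ i)))) (ℤ.+-identityʳ _)

-- Counting by filtering finite lists.

length-filter-⊎ : ∀ {A : Set} {P Q R : Pred A 0ℓ}
  (P? : Decidable P) (Q? : Decidable Q) (R? : Decidable R) →
  (∀ {x} → P x → Q x ⊎ R x) → Q ⊆ P → R ⊆ P → (∀ {x} → Q x → ¬ R x) →
  ∀ xs → length (filter P? xs) ≡ length (filter Q? xs) ℕ.+ length (filter R? xs)
length-filter-⊎ P? Q? R? split Q⊆P R⊆P disjoint = go
  where
  go : ∀ xs → length (filter P? xs) ≡ length (filter Q? xs) ℕ.+ length (filter R? xs)
  go [] = refl
  go (x ∷ xs) with P? x | Q? x | R? x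
  ... | _      | yes q | yes r = contradiction r (disjoint q)
  ... | no ¬p  | yes q | _     = contradiction (Q⊆P q) ¬p
  ... | no ¬p  | _     | yes r = contradiction (R⊆P r) ¬p
  ... | yes _  | yes _ | no _  = cong suc (go xs)
  ... | yes _  | no _  | yes _ = trans (cong suc (go xs)) (sym (ℕ.+-suc _ _))
  ... | no _   | no _  | no _  = go xs
  ... | yes p  | no ¬q | no ¬r with split p
  ...   | inj₁ q = contradiction q ¬q
  ...   | inj₂ r = contradiction r ¬r

-- The image of the first list and the second list are both free of duplicates and have the same
-- elements, so they are permutations of each other.
length-filter-injection : ∀ {M N} {P : Pred (Fin M) 0ℓ} {Q : Pred (Fin N) 0ℓ}
  (P? : Decidable P) (Q? : Decidable Q)
  (u : Fin M → Fin N) → (∀ {i j} → u i ≡ u j → i ≡ j) →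
  (∀ i → P i → Q (u i)) → (∀ j → Q j → ∃ λ i → P i × j ≡ u i) →
  length (filter P? (allFin M)) ≡ length (filter Q? (allFin N))
length-filter-injection {M} {N} P? Q? u u-inj to from =
  trans (sym (length-map u (filter P? (allFin M))))
  (↭-length (∼bag⇒↭ (unique∧set⇒bag
    (Unique.map⁺ u-inj (Unique.filter⁺ P? (Unique.allFin⁺ M)))
    (Unique.filter⁺ Q? (Unique.allFin⁺ N))
    (mk⇔ left right))))
  where
  left : ∀ {x} → x ∈ₗ map u (filter P? (allFin M)) → x ∈ₗ filter Q? (allFin N)
  left x∈ with ∈-map⁻ u x∈
  ... | i , i∈ , refl =
    ∈-filter⁺ Q? (∈-allFin (u i)) (to i (proj₂ (∈-filter⁻ P? {xs = allFin M} i∈)))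
  right : ∀ {x} → x ∈ₗ filter Q? (allFin N) → x ∈ₗ map u (filter P? (allFin M))
  right {x} x∈ with from x (proj₂ (∈-filter⁻ Q? {xs = allFin N} x∈))
  ... | i , p , refl = ∈-map⁺ u (∈-filter⁺ P? (∈-allFin i) p)

-- Points of the cone and the coefficients of the h*-polynomial.

-- A bijection of `Fin N` with `C` modulo pointwise equality, the appropriate equality for vectors
-- that are functions.
record Enumeration {m} (C : Pred (Vector ℚ m) 0ℓ) (N : ℕ) : Set where
  field
    point           : Fin N → Vector ℚ m
    sound           : ∀ i → C (point i)
    index           : ∀ x → C x → Fin N
    point-index     : ∀ x x∈C → point (index x x∈C) ≗ x
    point-injective : ∀ i j → point i ≗ point j → i ≡ j
open Enumeration

-- The coefficient vectors of the lattice points in the linear span of the cone.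
record CoefficientLattice (m : ℕ) : Set₁ where
  field
    Member    : Pred (Vector ℚ m) 0ℓ
    plus      : ∀ {x y} → Member x → Member y → Member (λ i → x i ℚ.+ y i)
    neg       : ∀ {x} → Member x → Member (λ i → ℚ.- x i)
    integral∈ : ∀ {x} → (∀ i → Integral (x i)) → Member x
    height    : ∀ {x} → Member x → Integral (Σℚ.sum x)

  unit∈ : ∀ i → Member (unit i)
  unit∈ i = integral∈ (integral-unit i)

-- Interpolates between the whole cone at j = 0 and the half-open box at j = m. Each increase of j
-- accounts for one factor 1-t.
BelowOne : ∀ {m} → ℕ → Pred (Vector ℚ m) 0ℓ
BelowOne j x = ∀ i → toℕ i ℕ.< j → x i ℚ.< 1ℚ

belowOne? : ∀ {m} j → Decidable (BelowOne {m} j)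
belowOne? j x = Fin.all? λ i → (toℕ i ℕ.<? j) →-dec (x i ℚ.<? 1ℚ)

module _ {m} (Λ : CoefficientLattice m) where
  open CoefficientLattice Λ

  -- Each generator (vᵢ,1) has height one, so the height of a point is the sum of its coefficients.
  record Cone (k : ℕ) (x : Vector ℚ m) : Set where
    constructor cone
    field
      nonNegative : ∀ i → 0ℚ ℚ.≤ x i
      sum≡        : Σℚ.sum x ≡ fromℤ (+ k)
      member      : Member x
  open Cone public

  shiftUp : Fin m → Vector ℚ m → Vector ℚ m
  shiftUp j x i = x i ℚ.+ unit j i

  shiftDown : Fin m → Vector ℚ m → Vector ℚ m
  shiftDown j x i = x i ℚ.- unit j i

  shiftUp-cone : ∀ j {k x} → Cone k x → Cone (suc k) (shiftUp j x)
  shiftUp-cone j {k} {x} (cone 0≤x s x∈) = cone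
    (λ i → ℚ.+-mono-≤ (0≤x i) (0≤unit j i))
    (trans (Σℚ.∑-distrib-+ x (unit j)) (trans (cong₂ ℚ._+_ s (sum-unit j))
      (trans (ℚ.+-comm (fromℤ (+ k)) 1ℚ) (sym (fromℤ-+ (+ 1) (+ k))))))
    (plus x∈ (unit∈ j))

  shiftDown-cone : ∀ j {k x} → 1ℚ ℚ.≤ x j → Cone (suc k) x → Cone k (shiftDown j x)
  shiftDown-cone j {k} {x} 1≤xj (cone 0≤x s x∈) = cone nonNeg height≡ (plus x∈ (neg (unit∈ j)))
    where
    open ℚ-Solver
    nonNeg : ∀ i → 0ℚ ℚ.≤ shiftDown j x i
    nonNeg i with j Fin.≟ i
    ... | yes refl rewrite unit-diagonal j = ℚ.+-monoˡ-≤ (ℚ.- 1ℚ) 1≤xj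
    ... | no j≢i rewrite unit-off-diagonal j≢i = subst (0ℚ ℚ.≤_) (sym (ℚ.+-identityʳ (x i))) (0≤x i)
    height≡ : Σℚ.sum (shiftDown j x) ≡ fromℤ (+ k)
    height≡ = begin
      Σℚ.sum (shiftDown j x)                            ≡⟨ Σℚ.∑-distrib-+ x (ℚ.-_ ∘ unit j) ⟩
      Σℚ.sum x ℚ.+ Σℚ.sum (ℚ.-_ ∘ unit j)
        ≡⟨ cong₂ ℚ._+_ s (trans (sum-neg (unit j)) (cong ℚ.-_ (sum-unit j))) ⟩
      fromℤ (+ suc k) ℚ.- 1ℚ                            ≡⟨ cong (ℚ._- 1ℚ) (fromℤ-+ (+ 1) (+ k)) ⟩
      (1ℚ ℚ.+ fromℤ (+ k)) ℚ.- 1ℚ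
        ≡⟨ solve 2 (λ o x → (o :+ x) :- o := x) refl 1ℚ (fromℤ (+ k)) ⟩
      fromℤ (+ k)                                       ∎
      where open ≡-Reasoning

  module _ (L : ℕ → ℕ) (enumerate : ∀ k → Enumeration (Cone k) (L k)) where

    belowOneCount : ℕ → ℕ → ℕ
    belowOneCount j k = length (filter (belowOne? j ∘ point (enumerate k)) (allFin (L k)))

    private
      -- Used with n = `toℕ j`: the points that are lost when coefficient j, too, is required to be
      -- < 1.
      Reaches : ℕ → Fin m → Pred (Vector ℚ m) 0ℓ
      Reaches n j x = BelowOne n x × 1ℚ ℚ.≤ x j

      reaches? : ∀ n j → Decidable (Reaches n j)
      reaches? n j x = belowOne? n x ×-dec (1ℚ ℚ.≤? x j)

      reachingCount : Fin m → ℕ → ℕ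
      reachingCount j k = length (filter (reaches? (toℕ j) j ∘ point (enumerate k)) (allFin (L k)))

      belowOneCount-split : ∀ j k →
        belowOneCount (toℕ j) k ≡ belowOneCount (suc (toℕ j)) k ℕ.+ reachingCount j k
      belowOneCount-split j k = length-filter-⊎ _ _ _ (λ {i} → split (point (enumerate k) i))
          (λ b i i<j → b i (ℕ.m<n⇒m<1+n i<j)) proj₁
            (λ b r → <⇒≱ (b j ℕ.≤-refl) (proj₂ r)) (allFin (L k))
        where
        split : ∀ x → BelowOne (toℕ j) x → BelowOne (suc (toℕ j)) x ⊎ Reaches (toℕ j) j x
        split x b with x j ℚ.<? 1ℚ
        ... | no ¬lt = inj₂ (b , ℚ.≮⇒≥ ¬lt)
        ... | yes lt = inj₁ bounded
          where
          bounded : BelowOne (suc (toℕ j)) x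
          bounded i i≤j with j Fin.≟ i
          ... | yes refl = lt
          ... | no j≢i = b i (ℕ.≤∧≢⇒< (ℕ.s≤s⁻¹ i≤j) (j≢i ∘ sym ∘ toℕ-injective))

      -- Coefficients are non-negative, so each is at most the height, which is 0 here.
      reachingCount-zero : ∀ j → reachingCount j 0 ≡ 0
      reachingCount-zero j = cong length (filter-none
        (reaches? (toℕ j) j ∘ point (enumerate 0)) {allFin (L 0)} (All.tabulate λ {i} _ → none i))
        where
        none : ∀ i → ¬ Reaches (toℕ j) j (point (enumerate 0) i)
        none i (_ , 1≤x) with sound (enumerate 0) i
        ... | cone 0≤x s _ = <⇒≱ {0ℚ} {1ℚ} (ℚ.positive⁻¹ 1ℚ)
          (ℚ.≤-trans 1≤x
            (subst (point (enumerate 0) i j ℚ.≤_) s (term≤sum (point (enumerate 0) i) 0≤x j)))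

      -- Translation by `unit j` is the bijection. It raises the height by one, turns coefficient j
      -- ≥ 0 into one ≥ 1, and fixes the coefficients before j, which are the ones bounded by 1.
      reachingCount-suc : ∀ j k → belowOneCount (toℕ j) k ≡ reachingCount j (suc k)
      reachingCount-suc j k =
        length-filter-injection _ _ u u-injective below⇒reaches reaches⇒below
        where
        E  = enumerate k
        E′ = enumerate (suc k)
        up : ∀ i → Cone (suc k) (shiftUp j (point E i))
        up i = shiftUp-cone j (sound E i)
        u : Fin (L k) → Fin (L (suc k))
        u i = index E′ _ (up i)
        point-u : ∀ i → point E′ (u i) ≗ shiftUp j (point E i)
        point-u i = point-index E′ _ (up i)
        u-injective : ∀ {i i′} → u i ≡ u i′ → i ≡ i′
        u-injective {i} {i′} eq =
          point-injective E i i′ λ l → +-cancelʳ (unit j l) (point E i l) (point E i′ l)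
          (trans (sym (point-u i l)) (trans (cong (λ a → point E′ a l) eq) (point-u i′ l)))
        below⇒reaches : ∀ i → BelowOne (toℕ j) (point E i) → Reaches (toℕ j) j (point E′ (u i))
        below⇒reaches i b =
          (λ l l<j → subst (ℚ._< 1ℚ)
            (sym (trans (point-u i l) (trans (cong (point E i l ℚ.+_) (unit-below j l l<j))
              (ℚ.+-identityʳ (point E i l)))))
            (b l l<j)) ,
          subst (1ℚ ℚ.≤_) (sym (trans (point-u i j) (cong (point E i j ℚ.+_) (unit-diagonal j))))
            (ℚ.+-monoˡ-≤ 1ℚ (nonNegative (sound E i) j))
        reaches⇒below : ∀ i′ → Reaches (toℕ j) j (point E′ i′) →
          ∃ λ i → BelowOne (toℕ j) (point E i) × i′ ≡ u i
        reaches⇒below i′ (b , 1≤x) = i , bounded , point-injective E′ i′ (u i) eq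
          where
          y∈ = shiftDown-cone j 1≤x (sound E′ i′)
          i = index E _ y∈
          bounded : BelowOne (toℕ j) (point E i)
          bounded l l<j = subst (ℚ._< 1ℚ)
            (sym (trans (point-index E _ y∈ l)
              (trans (cong (λ z → point E′ i′ l ℚ.- z) (unit-below j l l<j))
                (ℚ.+-identityʳ (point E′ i′ l)))))
            (b l l<j)
          eq : point E′ i′ ≗ point E′ (u i)
          eq l = sym (trans (point-u i l) (trans (cong (ℚ._+ unit j l) (point-index E _ y∈ l))
            (solve 2 (λ x y → (x :- y) :+ y := x) refl (point E′ i′ l) (unit j l))))
            where open ℚ-Solver

    -- Induction on j. Writing B for `belowOneCount`, the splitting and the translation give B (j+1)
    -- (k+1) = B j (k+1) - B j k, which is the effect of a factor 1-t on coefficients.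
    belowOneCount-[1-t]^ : ∀ j → j ℕ.≤ m → ∀ k → + belowOneCount j k ≡ ([1-t]^ j ⊛ (+_ ∘ L)) k
    belowOneCount-[1-t]^ 0 _ k = trans (cong +_ all) (sym ([1-t]^0⊛ (+_ ∘ L) k))
      where
      all : belowOneCount 0 k ≡ L k
      all = trans (cong length (filter-all (belowOne? 0 ∘ point (enumerate k)) {allFin (L k)}
        (All.tabulate λ _ _ ()))) (length-tabulate {n = L k} (λ i → i))
    belowOneCount-[1-t]^ (suc j) j<m k = trans (step k) (sym (1-t⊛-assoc ([1-t]^ j) (+_ ∘ L) k))
      where
      j′ = fromℕ< j<m
      IH = belowOneCount-[1-t]^ j (ℕ.<⇒≤ j<m)
      -- The splitting lemma speaks of `toℕ j′`, which equals j only propositionally.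
      split : ∀ k → belowOneCount j k ≡ belowOneCount (suc j) k ℕ.+ reachingCount j′ k
      split k = subst (λ n → belowOneCount n k ≡ belowOneCount (suc n) k ℕ.+ reachingCount j′ k)
        (toℕ-fromℕ< j<m) (belowOneCount-split j′ k)
      step : ∀ k → + belowOneCount (suc j) k ≡ (1-t ⊛ ([1-t]^ j ⊛ (+_ ∘ L))) k
      -- At height 0 no point is lost, just as 1-t preserves the constant term.
      step 0 = begin
        + belowOneCount (suc j) 0                          ≡⟨ cong +_ (ℕ.+-identityʳ _) ⟨
        + (belowOneCount (suc j) 0 ℕ.+ 0)
          ≡⟨ cong (λ r → + (belowOneCount (suc j) 0 ℕ.+ r)) (reachingCount-zero j′) ⟨
        + (belowOneCount (suc j) 0 ℕ.+ reachingCount j′ 0) ≡⟨ cong +_ (split 0) ⟨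
        + belowOneCount j 0                                ≡⟨ IH 0 ⟩
        ([1-t]^ j ⊛ (+_ ∘ L)) 0                           ≡⟨ 1-t⊛-zero ([1-t]^ j ⊛ (+_ ∘ L)) ⟨
        (1-t ⊛ ([1-t]^ j ⊛ (+_ ∘ L))) 0                   ∎
        where open ≡-Reasoning
      step (suc k) = begin
        + belowOneCount (suc j) (suc k)
          ≡⟨ solve 2 (λ a b → a := (a :+ b) :- b) refl (+ belowOneCount (suc j) (suc k))
            (+ belowOneCount j k) ⟩
        + (belowOneCount (suc j) (suc k) ℕ.+ belowOneCount j k) ℤ.- + belowOneCount j k
          ≡⟨ cong (λ r → + (belowOneCount (suc j) (suc k) ℕ.+ r) ℤ.- + belowOneCount j k)
               (trans (cong (λ n → belowOneCount n k) (sym (toℕ-fromℕ< j<m)))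
                 (reachingCount-suc j′ k)) ⟩
        + (belowOneCount (suc j) (suc k) ℕ.+ reachingCount j′ (suc k)) ℤ.- + belowOneCount j k
          ≡⟨ cong (λ r → + r ℤ.- + belowOneCount j k) (split (suc k)) ⟨
        + belowOneCount j (suc k) ℤ.- + belowOneCount j k
          ≡⟨ cong₂ ℤ._-_ (IH (suc k)) (IH k) ⟩
        ([1-t]^ j ⊛ (+_ ∘ L)) (suc k) ℤ.- ([1-t]^ j ⊛ (+_ ∘ L)) k
          ≡⟨ 1-t⊛-suc ([1-t]^ j ⊛ (+_ ∘ L)) k ⟨
        (1-t ⊛ ([1-t]^ j ⊛ (+_ ∘ L))) (suc k) ∎
        where
        open ≡-Reasoning
        open ℤ-Solver

    boxPoint⇒belowOneCount>0 : ∀ {k x} → Cone k x → (∀ i → x i ℚ.< 1ℚ) → 0 ℕ.< belowOneCount m k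
    boxPoint⇒belowOneCount>0 {k} {x} x∈ x<1 =
      nonempty (∈-filter⁺ (belowOne? m ∘ point (enumerate k)) (∈-allFin i)
        (λ l _ → subst (ℚ._< 1ℚ) (sym (point-index (enumerate k) x x∈ l)) (x<1 l)))
      where
      i = index (enumerate k) x x∈
      nonempty : ∀ {A : Set} {a : A} {xs} → a ∈ₗ xs → 0 ℕ.< length xs
      nonempty {xs = _ ∷ _} _ = ℕ.s≤s ℕ.z≤n

-- Non-integral coordinates of subset sums.

-- Σ_{S ⊆ gs} w (x + Σ S)
sumOverSubsets : ∀ {m} → (Vector ℚ m → ℕ) → Vector ℚ m → List (Vector ℚ m) → ℕ
sumOverSubsets w x []       = w x
sumOverSubsets w x (g ∷ gs) = sumOverSubsets w x gs ℕ.+ sumOverSubsets w (λ i → x i ℚ.+ g i) gs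

sumOverSubsets-sum : ∀ {m n} (φ : Fin n → Vector ℚ m → ℕ) x gs →
  sumOverSubsets (λ y → Σℕ.sum (λ i → φ i y)) x gs ≡ Σℕ.sum (λ i → sumOverSubsets (φ i) x gs)
sumOverSubsets-sum φ x []       = refl
sumOverSubsets-sum φ x (g ∷ gs) = trans
  (cong₂ ℕ._+_ (sumOverSubsets-sum φ x gs) (sumOverSubsets-sum φ (λ i → x i ℚ.+ g i) gs))
  (sym (Σℕ.∑-distrib-+ (λ i → sumOverSubsets (φ i) x gs)
    (λ i → sumOverSubsets (φ i) (λ i → x i ℚ.+ g i) gs)))

module _ {m} (i : Fin m) where

  private
    T : Vector ℚ m → List (Vector ℚ m) → ℕ
    T = sumOverSubsets (λ y → nonIntegral (y i))

  -- Adding the same subset sum to x and to y preserves their difference at i, so for each of the 2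
  -- ^ length gs subsets at least one of the two results is non-integral there.
  sumOverSubsets-separated : ∀ x y gs → ¬ Integral (y i ℚ.- x i) →
    2 ^ length gs ℕ.≤ T x gs ℕ.+ T y gs
  sumOverSubsets-separated x y []       ¬int = nonIntegral-separated {x i} {y i} ¬int
  sumOverSubsets-separated x y (g ∷ gs) ¬int = begin
    2 ^ length (g ∷ gs)
      ≡⟨ solve 1 (λ p → con 2 :* p := p :+ p) refl (2 ^ length gs) ⟩
    2 ^ length gs ℕ.+ 2 ^ length gs
      ≤⟨ ℕ.+-mono-≤ (sumOverSubsets-separated x y gs ¬int)
           (sumOverSubsets-separated _ _ gs (¬int ∘ subst Integral shift)) ⟩
    (T x gs ℕ.+ T y gs) ℕ.+ (T x+g gs ℕ.+ T y+g gs)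
      ≡⟨ solve 4 (λ a b c d → (a :+ b) :+ (c :+ d) := (a :+ c) :+ (b :+ d)) refl (T x gs)
          (T y gs) (T x+g gs) (T y+g gs) ⟩
    T x (g ∷ gs) ℕ.+ T y (g ∷ gs)                  ∎
    where
    open ℕ.≤-Reasoning
    open ℕ-Solver
    x+g y+g : Vector ℚ m
    x+g i = x i ℚ.+ g i
    y+g i = y i ℚ.+ g i
    shift : y+g i ℚ.- x+g i ≡ y i ℚ.- x i
    shift = Q.solve 3 (λ x y g → (y Q.:+ g) Q.:- (x Q.:+ g) Q.:= y Q.:- x) refl (x i) (y i) (g i)
      where module Q = ℚ-Solver

  -- Pair each subset without the non-integral g with the subset obtained by adding g: at least one
  -- of the two sums is non-integral at i, hence at least half of all sums are.
  sumOverSubsets-nonIntegral : ∀ x gs → Any (λ g → ¬ Integral (g i)) gs →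
    2 ^ length gs ℕ.≤ 2 ℕ.* T x gs
  sumOverSubsets-nonIntegral x (g ∷ gs) (here ¬int) =
    ℕ.*-monoʳ-≤ 2 (sumOverSubsets-separated x _ gs (¬int ∘ subst Integral
      (solve 2 (λ x g → (x :+ g) :- x := g) refl (x i) (g i))))
    where open ℚ-Solver
  sumOverSubsets-nonIntegral x (g ∷ gs) (there any) = begin
    -- The product `2 * p` unfolds to `p + (p + 0)`; the second copy of the induction hypothesis has
    -- to carry the trailing 0.
    2 ℕ.* 2 ^ length gs                  ≤⟨ ℕ.+-mono-≤
      (sumOverSubsets-nonIntegral x gs any) (ℕ.+-monoˡ-≤ 0 (sumOverSubsets-nonIntegral x+g gs any)) ⟩
    2 ℕ.* T x gs ℕ.+ (2 ℕ.* T x+g gs ℕ.+ 0)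
      ≡⟨ solve 2 (λ a b → con 2 :* a :+ (con 2 :* b :+ con 0) := con 2 :* (a :+ b)) refl
          (T x gs) (T x+g gs) ⟩
    2 ℕ.* T x (g ∷ gs)                   ∎
    where
    open ℕ.≤-Reasoning
    open ℕ-Solver
    x+g : Vector ℚ m
    x+g i = x i ℚ.+ g i

-- Double counting non-integral coordinates.

module _ {m} (Λ : CoefficientLattice m) where
  open CoefficientLattice Λ

  support : Vector ℚ m → ℕ
  support x = Σℕ.sum (λ i → nonIntegral (x i))

  support-0 : support (λ _ → 0ℚ) ≡ 0
  support-0 = trans (sum-const m 0) (ℕ.*-zeroʳ m)

  0∈ : Member (λ _ → 0ℚ)
  0∈ = integral∈ (λ _ → integral (+ 0) refl)

  module _ (D : ℕ) (support≤ : ∀ {x} → Member x → support x ℕ.≤ D) where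

    sumOverSubsets-≤ : ∀ {x gs} → Member x → All Member gs →
      sumOverSubsets support x gs ℕ.≤ 2 ^ length gs ℕ.* D
    sumOverSubsets-≤ x∈ []         = subst (_ ℕ.≤_) (sym (ℕ.*-identityˡ D)) (support≤ x∈)
    sumOverSubsets-≤ {x} {g ∷ gs} x∈ (g∈ ∷ gs∈) = begin
      sumOverSubsets support x (g ∷ gs)
        ≤⟨ ℕ.+-mono-≤ (sumOverSubsets-≤ x∈ gs∈) (sumOverSubsets-≤ (plus x∈ g∈) gs∈) ⟩
      2 ^ length gs ℕ.* D ℕ.+ 2 ^ length gs ℕ.* D
        ≡⟨ solve 2 (λ p d → p :* d :+ p :* d := (con 2 :* p) :* d) refl (2 ^ length gs) D ⟩
      2 ^ length (g ∷ gs) ℕ.* D                         ∎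
      where
      open ℕ.≤-Reasoning
      open ℕ-Solver

    -- The empty subset contributes support 0 instead of up to D. The `D` saved in this way settles
    -- the borderline case 2D = m of the double count.
    sumOverSubsets-0-≤ : ∀ {gs} → All Member gs →
      sumOverSubsets support (λ _ → 0ℚ) gs ℕ.+ D ℕ.≤ 2 ^ length gs ℕ.* D
    sumOverSubsets-0-≤ [] = ℕ.≤-reflexive (trans (cong (ℕ._+ D) support-0) (sym (ℕ.*-identityˡ D)))
    sumOverSubsets-0-≤ {g ∷ gs} (g∈ ∷ gs∈) = begin
      (a ℕ.+ b) ℕ.+ D
        ≡⟨ solve 3 (λ a b d → (a :+ b) :+ d := (a :+ d) :+ b) refl a b D ⟩
      (a ℕ.+ D) ℕ.+ b
        ≤⟨ ℕ.+-mono-≤ (sumOverSubsets-0-≤ gs∈) (sumOverSubsets-≤ (plus 0∈ g∈) gs∈) ⟩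
      2 ^ length gs ℕ.* D ℕ.+ 2 ^ length gs ℕ.* D
        ≡⟨ solve 2 (λ p d → p :* d :+ p :* d := (con 2 :* p) :* d) refl (2 ^ length gs) D ⟩
      2 ^ length (g ∷ gs) ℕ.* D                         ∎
      where
      open ℕ.≤-Reasoning
      open ℕ-Solver
      a = sumOverSubsets support (λ _ → 0ℚ) gs
      b = sumOverSubsets support (λ i → 0ℚ ℚ.+ g i) gs

    -- Counts pairs of a subset and a coordinate at which its sum is non-integral. By coordinates
    -- there are at least m · P / 2 of them, by subsets at most P · D - D, where P is the number of
    -- subsets.
    someCoordinateIntegral : 0 ℕ.< m → 2 ℕ.* D ℕ.≤ m → (g : Fin m → Vector ℚ m) →
      (∀ p → Member (g p)) →
      ¬ (∀ p → ¬ Integral (g p p))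
    someCoordinateIntegral 0<m 2D≤m g g∈ ¬int =
      ℕ.<⇒≱ (ℕ.*-mono-≤ 0<m (ℕ.m^n>0 2 (length gs)))
        (ℕ.≤-trans lower (ℕ.≤-reflexive (cong (2 ℕ.*_) W≡0)))
      where
      open ℕ.≤-Reasoning
      open ℕ-Solver
      -- The entry `g p` is the witness for coordinate p that `sumOverSubsets-nonIntegral` asks for.
      gs = List.tabulate g
      W = sumOverSubsets support (λ _ → 0ℚ) gs
      P = 2 ^ length gs
      upper : W ℕ.+ D ℕ.≤ P ℕ.* D
      upper = sumOverSubsets-0-≤ (All.tabulate⁺ g∈)
      lower : m ℕ.* P ℕ.≤ 2 ℕ.* W
      lower = begin
        m ℕ.* P                ≡⟨ sum-const m P ⟨
        Σℕ.sum {m} (λ _ → P)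
          ≤⟨ sum-mono-≤ _ _ (λ i → sumOverSubsets-nonIntegral i _ gs (Any.tabulate⁺ i (¬int i))) ⟩
        Σℕ.sum (λ i → 2 ℕ.* t i) ≡⟨ Σℕ.sum-cong-≗ (λ i → cong (t i ℕ.+_) (ℕ.+-identityʳ (t i))) ⟩
        Σℕ.sum (λ i → t i ℕ.+ t i) ≡⟨ Σℕ.∑-distrib-+ t t ⟩
        Σℕ.sum t ℕ.+ Σℕ.sum t
          ≡⟨ cong (λ s → s ℕ.+ s) (sumOverSubsets-sum (λ i y → nonIntegral (y i)) (λ _ → 0ℚ) gs) ⟨
        W ℕ.+ W                ≡⟨ cong (W ℕ.+_) (ℕ.+-identityʳ W) ⟨
        2 ℕ.* W                ∎
        where
        t : Fin m → ℕ
        t i = sumOverSubsets (λ y → nonIntegral (y i)) (λ _ → 0ℚ) gs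
      -- Doubling `upper`, then applying 2D ≤ m and `lower`, bounds 2W + 2D by 2W. With D = 0 the
      -- bound `upper` forces W = 0, while `lower` keeps 2W at least m · P > 0.
      D≡0 : D ≡ 0
      D≡0 = ℕ.m+n≡0⇒m≡0 D (ℕ.n≤0⇒n≡0 (ℕ.+-cancelˡ-≤ (2 ℕ.* W) _ _ (begin
        2 ℕ.* W ℕ.+ 2 ℕ.* D    ≡⟨ ℕ.*-distribˡ-+ 2 W D ⟨
        2 ℕ.* (W ℕ.+ D)        ≤⟨ ℕ.*-monoʳ-≤ 2 upper ⟩
        2 ℕ.* (P ℕ.* D)
          ≡⟨ solve 2 (λ p d → con 2 :* (p :* d) := (con 2 :* d) :* p) refl P D ⟩
        2 ℕ.* D ℕ.* P          ≤⟨ ℕ.*-monoˡ-≤ P 2D≤m ⟩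
        m ℕ.* P                ≤⟨ lower ⟩
        2 ℕ.* W                ≡⟨ ℕ.+-identityʳ _ ⟨
        2 ℕ.* W ℕ.+ 0          ∎)))
      W≡0 : W ≡ 0
      W≡0 = ℕ.n≤0⇒n≡0 (begin
        W         ≤⟨ ℕ.m≤m+n W D ⟩
        W ℕ.+ D   ≤⟨ upper ⟩
        P ℕ.* D   ≡⟨ cong (P ℕ.*_) D≡0 ⟩
        P ℕ.* 0   ≡⟨ ℕ.*-zeroʳ P ⟩
        0         ∎)

  -- From the degree bound to a coordinate integral on the whole lattice.

  module _ (L : ℕ → ℕ) (enumerate : ∀ k → Enumeration (Cone Λ k) (L k))
           (e : ℕ) (vanishing : ∀ i → e ℕ.< i → ([1-t]^ m ⊛ (+_ ∘ L)) i ≡ + 0) where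

    -- A box point at height k makes the k-th coefficient of the h*-polynomial positive, and these
    -- coefficients vanish beyond e.
    boxPoint-height≤ : ∀ {k x} → Cone Λ k x → (∀ i → x i ℚ.< 1ℚ) → k ℕ.≤ e
    boxPoint-height≤ {k} x∈ x<1 =
      ℕ.≮⇒≥ λ e<k → ℕ.<⇒≢ (boxPoint⇒belowOneCount>0 Λ L enumerate x∈ x<1)
      (sym (ℤ.+-injective
        (trans (belowOneCount-[1-t]^ Λ L enumerate m ℕ.≤-refl k) (vanishing k e<k))))

    -- The floors form an integral vector, so subtracting them stays inside the lattice. The result
    -- has coefficients in [0,1) and is therefore a box point.
    fractionalPart : ∀ {x} → Member x → ∃ λ k → k ℕ.≤ e × Cone Λ k (frac ∘ x)
    fractionalPart {x} x∈ = fromHeight (height frac∈)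
      where
      frac∈ : Member (frac ∘ x)
      frac∈ = plus x∈ (neg (integral∈ (λ i → integral-fromℤ (ℚ.floor (x i)))))
      fromHeight : Integral (Σℚ.sum (frac ∘ x)) → ∃ λ k → k ℕ.≤ e × Cone Λ k (frac ∘ x)
      fromHeight (integral (+ k) eq) = k , boxPoint-height≤ c (λ i → frac<1 (x i)) , c
        where c = cone (λ i → 0≤frac (x i)) eq frac∈
      fromHeight (integral -[1+ k ] eq) with () ← fromℤ-cancel-≤ (+ 0) -[1+ k ]
        (subst (0ℚ ℚ.≤_) eq (sum-nonNeg (frac ∘ x) (λ i → 0≤frac (x i))))

    -- By `frac+frac-` the support is the sum of the heights of two box points, the fractional parts
    -- of x and of -x.
    support≤2e : ∀ {x} → Member x → support x ℕ.≤ e ℕ.+ e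
    support≤2e {x} x∈ with fractionalPart x∈ | fractionalPart (neg x∈)
    ... | k , k≤e , c | k′ , k′≤e , c′ = subst (ℕ._≤ e ℕ.+ e) (sym eq) (ℕ.+-mono-≤ k≤e k′≤e)
      where
      open ≡-Reasoning
      eq : support x ≡ k ℕ.+ k′
      eq = ℤ.+-injective (fromℤ-injective _ _ (begin
        fromℤ (+ support x)
          ≡⟨ cong fromℤ (pos-sum (nonIntegral ∘ x)) ⟩
        fromℤ (Σℤ.sum (λ i → + nonIntegral (x i)))
          ≡⟨ fromℤ-sum (λ i → + nonIntegral (x i)) ⟩
        Σℚ.sum (λ i → fromℤ (+ nonIntegral (x i)))
          ≡⟨ Σℚ.sum-cong-≗ (λ i → frac+frac- (x i)) ⟨
        Σℚ.sum (λ i → frac (x i) ℚ.+ frac (ℚ.- x i))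
          ≡⟨ Σℚ.∑-distrib-+ (frac ∘ x) (λ i → frac (ℚ.- x i)) ⟩
        Σℚ.sum (frac ∘ x) ℚ.+ Σℚ.sum (λ i → frac (ℚ.- x i))
          ≡⟨ cong₂ ℚ._+_ (sum≡ c) (sum≡ c′) ⟩
        fromℤ (+ k) ℚ.+ fromℤ (+ k′)
          ≡⟨ fromℤ-+ (+ k) (+ k′) ⟨
        fromℤ (+ (k ℕ.+ k′)) ∎))

    -- Restricted to the finitely many points of heights 0 to e, so that it is decidable and its
    -- failure yields an explicit point. The restriction loses nothing, as every member differs by
    -- an integral vector from a box point of such a height.
    IntegralAt : Fin m → Set
    IntegralAt p = ∀ (k : Fin (suc e)) i → Integral (point (enumerate (toℕ k)) i p)

    integralAt? : Decidable IntegralAt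
    integralAt? p = Fin.all? λ k → Fin.all? λ i → integral? _

    integralAt⇒ : ∀ {p} → IntegralAt p → ∀ {x} → Member x → Integral (x p)
    integralAt⇒ {p} int {x} x∈ with fractionalPart x∈
    ... | k , k≤e , c = integral-frac⁻ (subst Integral (point-index (enumerate k) _ c p)
      (subst (λ k → ∀ i → Integral (point (enumerate k) i p)) (toℕ-fromℕ< (ℕ.s≤s k≤e))
        (int (fromℕ< (ℕ.s≤s k≤e))) _))

    ¬integralAt⇒ : ∀ {p} → ¬ IntegralAt p → ∃ λ x → Member x × ¬ Integral (x p)
    ¬integralAt⇒ {p} ¬int with Fin.¬∀⟶∃¬ _ _ (λ k → Fin.all? λ i → integral? _) ¬int
    ... | k , ¬int′ with Fin.¬∀⟶∃¬ _ _ (λ i → integral? _) ¬int′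
    ...   | i , ¬int″ = _ , member (sound (enumerate (toℕ k)) i) , ¬int″

    -- The double count only refutes that every coordinate fails; deciding `IntegralAt` for each
    -- coordinate turns this into an actual one. It is applied with D = 2e, whence 4e ≤ m.
    apex : 0 ℕ.< m → 4 ℕ.* e ℕ.≤ m → Σ (Fin m) λ p → ∀ {x} → Member x → Integral (x p)
    apex 0<m 4e≤m with Fin.any? integralAt?
    ... | yes (p , int) = p , integralAt⇒ int
    ... | no none = contradiction (λ p → proj₂ (proj₂ (witness p)))
      (someCoordinateIntegral (e ℕ.+ e) support≤2e 0<m
        (subst (ℕ._≤ m) (solve 1 (λ e → con 4 :* e := con 2 :* (e :+ e)) refl e) 4e≤m)
        (λ p → proj₁ (witness p)) (λ p → proj₁ (proj₂ (witness p))))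
      where
      open ℕ-Solver
      witness : ∀ p → ∃ λ x → Member x × ¬ Integral (x p)
      witness p = ¬integralAt⇒ (λ int → none (p , int))

-- Affine combinations of lattice points.

private variable
  c ℓ c′ ℓ′ : Level

module _ (M : Lattice c ℓ) where
  open Lattice M

  combination-cong : ∀ {m} {a b : Vector ℚ m} (v : Vector Carrier m) → a ≗ b →
    combination M a v ≗ combination M b v
  combination-cong v a≗b j = Σℚ.sum-cong-≗ (λ i → cong (ℚ._* ι M (v i) j) (a≗b i))

  combination-+ : ∀ {m} (a b : Vector ℚ m) (v : Vector Carrier m) j →
    combination M (λ i → a i ℚ.+ b i) v j ≡ combination M a v j ℚ.+ combination M b v j
  combination-+ a b v j = trans
    (Σℚ.sum-cong-≗ (λ i → ℚ.*-distribʳ-+ (ι M (v i) j) (a i) (b i)))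
    (Σℚ.∑-distrib-+ (λ i → a i ℚ.* ι M (v i) j) (λ i → b i ℚ.* ι M (v i) j))

  combination-* : ∀ {m} t (a : Vector ℚ m) (v : Vector Carrier m) j →
    combination M (λ i → t ℚ.* a i) v j ≡ t ℚ.* combination M a v j
  combination-* t a v j = trans
    (Σℚ.sum-cong-≗ (λ i → ℚ.*-assoc t (a i) (ι M (v i) j)))
    (sym (*-distribˡ-sum t (λ i → a i ℚ.* ι M (v i) j)))

  combination-neg : ∀ {m} (a : Vector ℚ m) (v : Vector Carrier m) j →
    combination M (λ i → ℚ.- a i) v j ≡ ℚ.- combination M a v j
  combination-neg a v j = trans
    (Σℚ.sum-cong-≗ (λ i → sym (ℚ.neg-distribˡ-* (a i) (ι M (v i) j))))
    (sum-neg (λ i → a i ℚ.* ι M (v i) j))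

  combination-unit : ∀ {m} i (v : Vector Carrier m) → combination M (unit i) v ≗ ι M (v i)
  combination-unit i v j = sum-unit* i (λ l → ι M (v l) j)

  combination-0∷ : ∀ {m} (a : Vector ℚ m) (v : Vector Carrier (suc m)) →
    combination M (0ℚ ∷ᵛ a) v ≗ combination M a (tail v)
  combination-0∷ a v j = trans (cong (ℚ._+ combination M a (tail v) j) (ℚ.*-zeroˡ (ι M (v zero) j)))
    (ℚ.+-identityˡ (combination M a (tail v) j))

  generator∈convexHull : ∀ {m} (v : Vector Carrier m) i → ι M (v i) ∈ ConvexHull M v
  generator∈convexHull v i = unit i , 0≤unit i , sum-unit i , combination-unit i v

  convexHull⊆affineHull : ∀ {m} {v : Vector Carrier m} → ConvexHull M v ⊆ AffineHull M v
  convexHull⊆affineHull (a , _ , s , eq) = a , s , eq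

  ι-injective : ∀ {x y} → ι M x ≗ ι M y → x ≈ y
  ι-injective eq =
    GroupMorphisms.IsGroupIsomorphism.injective coord-iso (λ j → fromℤ-injective _ _ (eq j))

  ι-cong : ∀ {x y} → x ≈ y → ι M x ≗ ι M y
  ι-cong x≈y j = cong fromℤ (GroupMorphisms.IsGroupIsomorphism.⟦⟧-cong coord-iso x≈y j)

  fromCoord : Vector ℤ rank → Carrier
  fromCoord y = proj₁ (GroupMorphisms.IsGroupIsomorphism.surjective coord-iso y)

  coord-fromCoord : ∀ y → coord (fromCoord y) ≗ y
  coord-fromCoord y = proj₂ (GroupMorphisms.IsGroupIsomorphism.surjective coord-iso y)
    (AbelianGroup.refl abelianGroup)

  independent⇒unique : ∀ {m} (v : Vector Carrier m) → AffinelyIndependent M v → ∀ {a b} →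
    Σℚ.sum a ≡ Σℚ.sum b → combination M a v ≗ combination M b v → a ≗ b
  independent⇒unique v ind {a} {b} sa≡sb eq i = x-y≡0⇒x≡y (a i) (b i) (ind (λ i → a i ℚ.- b i)
    (trans (Σℚ.∑-distrib-+ a (ℚ.-_ ∘ b))
      (trans (cong₂ ℚ._+_ sa≡sb (sum-neg b)) (ℚ.+-inverseʳ (Σℚ.sum b))))
    (λ j → trans (combination-+ a (ℚ.-_ ∘ b) v j)
      (trans (cong₂ ℚ._+_ (eq j) (combination-neg b v j)) (ℚ.+-inverseʳ (combination M b v j))))
    i)

  independent-tail : ∀ {m} (v : Vector Carrier (suc m)) → AffinelyIndependent M v →
    AffinelyIndependent M (tail v)
  independent-tail v ind a s eq i = ind (0ℚ ∷ᵛ a) (trans (ℚ.+-identityˡ _) s)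
    (λ j → trans (combination-0∷ a v j) (eq j)) (suc i)

  -- Coefficient vectors, with respect to the (vᵢ,1), of the points of M ⊕ ℤ in their rational span:
  -- both the M-part and the height have to be integral.
  coefficientLattice : ∀ {m} → Vector Carrier m → CoefficientLattice m
  coefficientLattice v = record
    { Member    = λ a → Integral (Σℚ.sum a) × (∀ j → Integral (combination M a v j))
    ; plus      = λ {a} {b} (s , h) (s′ , h′) →
                    subst Integral (sym (Σℚ.∑-distrib-+ a b)) (integral-+ s s′) ,
                    λ j → subst Integral (sym (combination-+ a b v j)) (integral-+ (h j) (h′ j))
    ; neg       = λ {a} (s , h) → subst Integral (sym (sum-neg a)) (integral-neg s) ,
                    λ j → subst Integral (sym (combination-neg a v j)) (integral-neg (h j))
    ; integral∈ = λ {a} h → integral-sum a h ,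
                    λ j → integral-sum (λ i → a i ℚ.* ι M (v i) j)
                      (λ i → integral-* (h i) (integral-fromℤ (coord (v i) j)))
    ; height    = proj₁
    }

  -- Lattice points of dilates as points of the cone.

  module _ {m} (v : Vector Carrier m) where
    private
      Λ = coefficientLattice v

    -- Non-negative coefficients with sum 0 all vanish, so the apex of the cone is the only point,
    -- in accordance with the value L 0 = 1 set in `IsHStar`.
    coneAtZero : ∀ {N} → N ≡ 1 → Enumeration (Cone Λ 0) N
    coneAtZero refl = record
      { point           = λ _ _ → 0ℚ
      ; sound           = λ _ → cone (λ _ → ℚ.≤-refl) (Σℚ.sum-replicate-zero m) (0∈ Λ)
      ; index           = λ _ _ → zero
      ; point-index     = λ x (cone 0≤x s _) i →
                            ℚ.≤-antisym (0≤x i) (subst (x i ℚ.≤_) s (term≤sum x 0≤x i))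
      ; point-injective = λ { zero zero _ → refl }
      }

    module _ (ind : AffinelyIndependent M v)
      (k N : ℕ) (count : CountsLatticePoints {M = M} (conv v) (suc k) N) where
      private
        module C = Inverse count

        -- `K` is the factor as it occurs in `Dilate`; `K′` is its normal form, whose being non-zero
        -- is visible to instance search.
        K K′ K⁻¹ : ℚ
        K   = fromℤ (+ suc k)
        K′  = mkℚ (+ suc k) 0 (Coprime.sym (Coprime.1-coprimeTo (suc k)))
        K⁻¹ = ℚ.1/ K′

        KK⁻¹≡1 : K ℚ.* K⁻¹ ≡ 1ℚ
        KK⁻¹≡1 = trans (cong (ℚ._* K⁻¹) (fromℤ-mkℚ (+ suc k))) (ℚ.*-inverseʳ K′)

        DilatePoint : Set c
        DilatePoint = Σ Carrier (λ x → ι M x ∈ Dilate {M = M} (suc k) (conv v))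

        coefficients : DilatePoint → Vector ℚ m
        coefficients (_ , _ , (a , _) , _) i = K ℚ.* a i

        coefficients-sum : ∀ X → Σℚ.sum (coefficients X) ≡ K
        coefficients-sum (_ , _ , (a , _ , s , _) , _) =
          trans (sym (*-distribˡ-sum K a)) (trans (cong (K ℚ.*_) s) (ℚ.*-identityʳ K))

        coefficients-combination : ∀ X → combination M (coefficients X) v ≗ ι M (proj₁ X)
        coefficients-combination (_ , _ , (a , _ , _ , eq) , eq′) j =
          trans (combination-* K a v j) (trans (cong (K ℚ.*_) (eq j)) (eq′ j))

        0≤K : 0ℚ ℚ.≤ K
        0≤K = fromℤ-mono-≤ (+ 0) (+ suc k) (ℤ.+≤+ ℕ.z≤n)

        0≤K⁻¹ : 0ℚ ℚ.≤ K⁻¹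
        0≤K⁻¹ = ℚ.nonNegative⁻¹ K⁻¹

        *-nonNeg : ∀ {p q} → 0ℚ ℚ.≤ p → 0ℚ ℚ.≤ q → 0ℚ ℚ.≤ p ℚ.* q
        *-nonNeg {p} {q} 0≤p 0≤q = ℚ.nonNegative⁻¹ (p ℚ.* q)
          {{ℚ.nonNeg*nonNeg⇒nonNeg p {{ℚ.nonNegative 0≤p}} q {{ℚ.nonNegative 0≤q}}}}

        coefficients-cone : ∀ X → Cone Λ (suc k) (coefficients X)
        coefficients-cone X@(x , _ , (a , 0≤a , _) , _) = cone
          (λ i → *-nonNeg 0≤K (0≤a i))
          (coefficients-sum X)
          (integral (+ suc k) (coefficients-sum X) ,
           λ j → integral (coord x j) (coefficients-combination X j))

        dilatePoint : ∀ a → Cone Λ (suc k) a → DilatePoint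
        dilatePoint a (cone 0≤a s (_ , h)) = fromCoord (λ j → integer (h j)) ,
          combination M a/K v ,
          (a/K , (λ i → *-nonNeg 0≤K⁻¹ (0≤a i)) ,
           trans (sym (*-distribˡ-sum K⁻¹ a))
             (trans (cong (K⁻¹ ℚ.*_) s) (trans (ℚ.*-comm K⁻¹ K) KK⁻¹≡1)) ,
           (λ _ → refl)) ,
          λ j → begin
            K ℚ.* combination M a/K v j             ≡⟨ cong (K ℚ.*_) (combination-* K⁻¹ a v j) ⟩
            K ℚ.* (K⁻¹ ℚ.* combination M a v j)     ≡⟨ ℚ.*-assoc K K⁻¹ _ ⟨
            K ℚ.* K⁻¹ ℚ.* combination M a v j       ≡⟨ cong (ℚ._* combination M a v j) KK⁻¹≡1 ⟩
            1ℚ ℚ.* combination M a v j              ≡⟨ ℚ.*-identityˡ _ ⟩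
            combination M a v j                     ≡⟨ equality (h j) ⟩
            fromℤ (integer (h j))                   ≡⟨ cong fromℤ (coord-fromCoord _ j) ⟨
            ι M (fromCoord (λ j → integer (h j))) j ∎
          where
          open ≡-Reasoning
          a/K : Vector ℚ m
          a/K i = K⁻¹ ℚ.* a i

        dilatePoint-ι : ∀ a (h : Cone Λ (suc k) a) →
          ι M (proj₁ (dilatePoint a h)) ≗ combination M a v
        dilatePoint-ι a (cone _ _ (_ , h)) j =
          trans (cong fromℤ (coord-fromCoord _ j)) (sym (equality (h j)))

      -- Scaling convex coefficients by `K` identifies the lattice points of the dilate with the
      -- cone points at that height. Affine independence makes the coefficients of a point unique,
      -- so the given count transfers.
      coneAtSuc : Enumeration (Cone Λ (suc k)) N
      coneAtSuc = record
        { point           = λ i → coefficients (C.from i)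
        ; sound           = λ i → coefficients-cone (C.from i)
        ; index           = λ a a∈ → C.to (dilatePoint a a∈)
        ; point-index     = λ a a∈ → independent⇒unique v ind
            (trans (coefficients-sum (C.from (C.to (dilatePoint a a∈)))) (sym (sum≡ a∈)))
            (λ j → trans (coefficients-combination (C.from (C.to (dilatePoint a a∈))) j)
              (trans (ι-cong (C.strictlyInverseʳ (dilatePoint a a∈)) j) (dilatePoint-ι a a∈ j)))
        ; point-injective = λ i i′ eq → trans (sym (C.strictlyInverseˡ i)) (trans
            (C.to-cong (ι-injective λ j → trans (sym (coefficients-combination (C.from i) j))
              (trans (combination-cong v eq j) (coefficients-combination (C.from i′) j))))
            (C.strictlyInverseˡ i′))
        }

    enumerateCones : AffinelyIndependent M v → (L : ℕ → ℕ) → L 0 ≡ 1 →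
      (∀ k → CountsLatticePoints {M = M} (conv v) (suc k) (L (suc k))) →
      ∀ k → Enumeration (Cone Λ k) (L k)
    enumerateCones ind L L0 count 0       = coneAtZero L0
    enumerateCones ind L L0 count (suc k) = coneAtSuc ind k (L (suc k)) (count k)

  -- The exponent suc n in `IsHStar` is the number of vertices, so after all factors 1-t have been
  -- used every coefficient has been bounded.
  integralCoordinate : ∀ {n} (v : Vector Carrier (suc n)) → AffinelyIndependent M v → ∀ {e} →
    HasDegree {M = M} n (conv v) e →
    4 ℕ.* e ℕ.≤ suc n →
    Σ (Fin (suc n))
      λ p → ∀ {a} → CoefficientLattice.Member (coefficientLattice v) a → Integral (a p)
  integralCoordinate v ind {e} (h , (L , L0 , count , _ , h≡) , _ , h≡0) =
    apex (coefficientLattice v) L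
    (enumerateCones v ind L L0 count) e (λ i e<i → trans (h≡ i) (cong +_ (h≡0 i e<i))) (ℕ.s≤s ℕ.z≤n)

-- Vertices of simplices in terms of barycentric coordinates.

isVertex-resp : {M : Lattice c ℓ} (P P′ : LatticePolytope M) → Points P ⊆ Points P′ →
  Points P′ ⊆ Points P →
  ∀ x → IsVertex P x → IsVertex P′ x
isVertex-resp P P′ P⊆P′ P′⊆P x (x∈ , extremal) =
  P⊆P′ x∈ , λ y z t y∈ z∈ → extremal y z t (P′⊆P y∈) (P′⊆P z∈)

-- In a simplex, being a vertex depends on the barycentric coordinates alone. A segment through x′
-- has end coefficients b and d that mix to a; the same b and d describe a segment through x, which
-- extremality of x collapses.
isVertex-transfer : (M : Lattice c ℓ) (M′ : Lattice c′ ℓ′) → ∀ {m}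
  (v : Vector (Lattice.Carrier M) m) (v′ : Vector (Lattice.Carrier M′) m) →
  AffinelyIndependent M v → AffinelyIndependent M′ v′ → ∀ a x x′ → Σℚ.sum a ≡ 1ℚ →
  combination M a v ≗ ι M x → combination M′ a v′ ≗ ι M′ x′ →
  IsVertex {M = M} (conv v) x → IsVertex {M = M′} (conv v′) x′
isVertex-transfer M M′ {m} v v′ ind ind′ a x x′ s eq eq′ ((a₀ , 0≤a₀ , s₀ , eq₀) , extremal) =
  (a₀ , 0≤a₀ , s₀ , λ j → trans (combination-cong M′ v′ a₀≗a j) (eq′ j)) , extremal′
  where
  a₀≗a : a₀ ≗ a
  a₀≗a = independent⇒unique M v ind (trans s₀ (sym s)) (λ j → trans (eq₀ j) (sym (eq j)))
  extremal′ : ∀ y z t → y ∈ ConvexHull M′ v′ → z ∈ ConvexHull M′ v′ → 0ℚ ℚ.< t → t ℚ.< 1ℚ →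
    _⊕_ M′ (_•_ M′ (1ℚ ℚ.- t) y) (_•_ M′ t z) ≗ ι M′ x′ → y ≗ z
  extremal′ y z t (b , 0≤b , sb , eqb) (d , 0≤d , sd , eqd) 0<t t<1 mid j =
    trans (sym (eqb j)) (trans (combination-cong M′ v′ b≗d j) (eqd j))
    where
    mix : Vector ℚ m
    mix i = (1ℚ ℚ.- t) ℚ.* b i ℚ.+ t ℚ.* d i
    mix-combination : ∀ {c ℓ} (N : Lattice c ℓ) w j → combination N mix w j ≡
      (1ℚ ℚ.- t) ℚ.* combination N b w j ℚ.+ t ℚ.* combination N d w j
    mix-combination N w j = trans (combination-+ N (λ i → (1ℚ ℚ.- t) ℚ.* b i) (λ i → t ℚ.* d i) w j)
      (cong₂ ℚ._+_ (combination-* N (1ℚ ℚ.- t) b w j) (combination-* N t d w j))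
    mix-sum : Σℚ.sum mix ≡ 1ℚ
    mix-sum = begin
      Σℚ.sum mix
        ≡⟨ Σℚ.∑-distrib-+ (λ i → (1ℚ ℚ.- t) ℚ.* b i) (λ i → t ℚ.* d i) ⟩
      Σℚ.sum (λ i → (1ℚ ℚ.- t) ℚ.* b i) ℚ.+ Σℚ.sum (λ i → t ℚ.* d i)
        ≡⟨ cong₂ ℚ._+_ (*-distribˡ-sum (1ℚ ℚ.- t) b) (*-distribˡ-sum t d) ⟨
      (1ℚ ℚ.- t) ℚ.* Σℚ.sum b ℚ.+ t ℚ.* Σℚ.sum d
        ≡⟨ cong₂ (λ p q → (1ℚ ℚ.- t) ℚ.* p ℚ.+ t ℚ.* q) sb sd ⟩
      (1ℚ ℚ.- t) ℚ.* 1ℚ ℚ.+ t ℚ.* 1ℚ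
        ≡⟨ solve 1 (λ t → (con 1ℚ :- t) :* con 1ℚ :+ t :* con 1ℚ := con 1ℚ) refl t ⟩
      1ℚ                                           ∎
      where
      open ≡-Reasoning
      open ℚ-Solver
    mix≗a : mix ≗ a
    mix≗a =
      independent⇒unique M′ v′ ind′ (trans mix-sum (sym s)) λ j → trans (mix-combination M′ v′ j)
      (trans (cong₂ (λ p q → (1ℚ ℚ.- t) ℚ.* p ℚ.+ t ℚ.* q) (eqb j) (eqd j))
        (trans (mid j) (sym (eq′ j))))
    b≗d : b ≗ d
    b≗d = independent⇒unique M v ind
      (trans sb (sym sd)) (extremal (combination M b v) (combination M d v) t
      (b , 0≤b , sb , λ _ → refl) (d , 0≤d , sd , λ _ → refl) 0<t t<1
      (λ j → trans (sym (mix-combination M v j)) (trans (combination-cong M v mix≗a j) (eq j))))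

-- An integral barycentric coordinate makes its vertex the apex of a lattice pyramid.

module LatticePyramid
  (M : Lattice c ℓ) {n} (P : LatticePolytope M) (u : Vector (Lattice.Carrier M) (suc n))
  (independent : AffinelyIndependent M u)
  (P⊆u : Points P ⊆ ConvexHull M u) (u⊆P : ConvexHull M u ⊆ Points P)
  (Aff⊆u : Aff P ⊆ AffineHull M u) (u⊆Aff : AffineHull M u ⊆ Aff P)
  (apexIntegral : ∀ a x → Σℚ.sum a ≡ 1ℚ → combination M a u ≗ ι M x → Integral (a zero))
  where
  open Lattice M

  private
    M′ : Lattice 0ℓ 0ℓ
    M′ = ℤ^ (suc rank)
    module M′ = Lattice M′

    base : LatticePolytope (ℤ^ rank)
    base = conv (λ i → coord (u (suc i)))

    P′ : LatticePolytope M′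
    P′ = standardPyramid 1 base

    w : Vector M′.Carrier (suc n)
    w = LatticePolytope.generators P′

    module A  = Setoid (AffineLattice P)
    module A′ = Setoid (AffineLattice P′)

    combination-w-zero : ∀ a → combination M′ a w zero ≡ Σℚ.sum (tail a)
    combination-w-zero a =
      trans (cong₂ ℚ._+_ (ℚ.*-zeroʳ (a zero)) (Σℚ.sum-cong-≗ (λ i → ℚ.*-identityʳ (a (suc i)))))
      (ℚ.+-identityˡ (Σℚ.sum (tail a)))

    combination-w-suc : ∀ a j → combination M′ a w (suc j) ≡ combination M (tail a) (tail u) j
    combination-w-suc a j =
      trans (cong (ℚ._+ combination M (tail a) (tail u) j) (ℚ.*-zeroʳ (a zero)))
      (ℚ.+-identityˡ (combination M (tail a) (tail u) j))

    -- The first coordinate of the relation says that the coefficients off the apex sum to 0, so the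
    -- apex coefficient vanishes as well. The remaining coordinates then give a relation among the
    -- points of `u`.
    independent-w : AffinelyIndependent M′ w
    independent-w a s eq = independent a s λ j → begin
      a zero ℚ.* ι M (u zero) j ℚ.+ combination M (tail a) (tail u) j
        ≡⟨ cong₂ (λ p q → p ℚ.* ι M (u zero) j ℚ.+ q) a₀≡0
          (trans (sym (combination-w-suc a j)) (eq (suc j))) ⟩
      0ℚ ℚ.* ι M (u zero) j ℚ.+ 0ℚ
        ≡⟨ trans (ℚ.+-identityʳ _) (ℚ.*-zeroˡ (ι M (u zero) j)) ⟩
      0ℚ ∎
      where
      open ≡-Reasoning
      a₀≡0 : a zero ≡ 0ℚ
      a₀≡0 = trans (sym (ℚ.+-identityʳ (a zero)))
        (trans (cong (a zero ℚ.+_) (trans (sym (eq zero)) (combination-w-zero a))) s)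

    -- If x = z v + Σ aᵢ uᵢ is an affine combination with apex v, the pyramid
    -- point with the same coefficients is z 0 + Σ aᵢ (1, uᵢ) = (1 − z, x − z v).
    -- Keeping all coordinates of M avoids choosing a basis of the facet's lattice.
    toPyramid : ℤ → Carrier → M′.Carrier
    toPyramid z x = (+ 1 ℤ.- z) ∷ᵛ (λ j → coord x j ℤ.- z ℤ.* coord (u zero) j)

    fromℤ-toPyramid : ∀ z x j →
      fromℤ (toPyramid z x (suc j)) ≡ ι M x j ℚ.- fromℤ z ℚ.* ι M (u zero) j
    fromℤ-toPyramid z x j =
      trans (fromℤ-+ (coord x j) (ℤ.- (z ℤ.* coord (u zero) j))) (cong (ι M x j ℚ.+_)
      (trans (fromℤ-neg (z ℤ.* coord (u zero) j)) (cong ℚ.-_ (fromℤ-* z (coord (u zero) j)))))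

    combination-toPyramid : ∀ a z x → Σℚ.sum a ≡ 1ℚ → a zero ≡ fromℤ z →
      combination M a u ≗ ι M x → combination M′ a w ≗ ι M′ (toPyramid z x)
    combination-toPyramid a z x s a₀ eq zero = begin
      combination M′ a w zero              ≡⟨ combination-w-zero a ⟩
      Σℚ.sum (tail a)
        ≡⟨ solve 2 (λ p q → q := (p :+ q) :- p) refl (a zero) (Σℚ.sum (tail a)) ⟩
      Σℚ.sum a ℚ.- a zero                  ≡⟨ cong₂ ℚ._-_ s a₀ ⟩
      1ℚ ℚ.- fromℤ z                       ≡⟨ cong (1ℚ ℚ.+_) (fromℤ-neg z) ⟨
      1ℚ ℚ.+ fromℤ (ℤ.- z)                 ≡⟨ fromℤ-+ (+ 1) (ℤ.- z) ⟨
      fromℤ (+ 1 ℤ.- z)                    ∎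
      where
      open ≡-Reasoning
      open ℚ-Solver
    combination-toPyramid a z x s a₀ eq (suc j) = begin
      combination M′ a w (suc j)               ≡⟨ combination-w-suc a j ⟩
      combination M (tail a) (tail u) j
        ≡⟨ solve 3 (λ p v q → q := (p :* v :+ q) :- p :* v) refl (a zero) (ι M (u zero) j) _ ⟩
      combination M a u j ℚ.- a zero ℚ.* ι M (u zero) j
        ≡⟨ cong₂ (λ p q → p ℚ.- q ℚ.* ι M (u zero) j) (eq j) a₀ ⟩
      ι M x j ℚ.- fromℤ z ℚ.* ι M (u zero) j   ≡⟨ fromℤ-toPyramid z x j ⟨
      fromℤ (toPyramid z x (suc j))            ∎
      where
      open ≡-Reasoning
      open ℚ-Solver

    -- The first coordinate of `toPyramid z x` is 1 - z, which recovers z; then z times the apex is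
    -- added back.
    fromPyramid : M′.Carrier → Carrier
    fromPyramid y = fromCoord M (λ j → y (suc j) ℤ.+ (+ 1 ℤ.- y zero) ℤ.* coord (u zero) j)

    toPyramid-fromPyramid : ∀ y → toPyramid (+ 1 ℤ.- y zero) (fromPyramid y) ≗ y
    toPyramid-fromPyramid y zero = solve 1 (λ y → con (+ 1) :- (con (+ 1) :- y) := y) refl (y zero)
      where open ℤ-Solver
    toPyramid-fromPyramid y (suc j) = trans
      (cong (ℤ._- (+ 1 ℤ.- y zero) ℤ.* coord (u zero) j) (coord-fromCoord M _ j))
      (solve 2 (λ y z → (y :+ z) :- z := y) refl (y (suc j))
        ((+ 1 ℤ.- y zero) ℤ.* coord (u zero) j))
      where open ℤ-Solver

    combination-fromPyramid : ∀ a y → Σℚ.sum a ≡ 1ℚ → combination M′ a w ≗ ι M′ y →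
      a zero ≡ fromℤ (+ 1 ℤ.- y zero) × combination M a u ≗ ι M (fromPyramid y)
    combination-fromPyramid a y s eq = a₀ , λ j → begin
      a zero ℚ.* ι M (u zero) j ℚ.+ combination M (tail a) (tail u) j
        ≡⟨ cong₂ (λ p q → p ℚ.* ι M (u zero) j ℚ.+ q) a₀
          (trans (sym (combination-w-suc a j)) (eq (suc j))) ⟩
      fromℤ z ℚ.* ι M (u zero) j ℚ.+ fromℤ (y (suc j))
        ≡⟨ cong (λ q → fromℤ z ℚ.* ι M (u zero) j ℚ.+ q)
             (trans (cong fromℤ (sym (toPyramid-fromPyramid y (suc j))))
               (fromℤ-toPyramid z (fromPyramid y) j)) ⟩
      fromℤ z ℚ.* ι M (u zero) j ℚ.+ (ι M (fromPyramid y) j ℚ.- fromℤ z ℚ.* ι M (u zero) j)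
        ≡⟨ solve 2 (λ p q → p :+ (q :- p) := q) refl (fromℤ z ℚ.* ι M (u zero) j)
          (ι M (fromPyramid y) j) ⟩
      ι M (fromPyramid y) j ∎
      where
      open ≡-Reasoning
      open ℚ-Solver
      z = + 1 ℤ.- y zero
      a₀ : a zero ≡ fromℤ z
      a₀ = begin
        a zero
          ≡⟨ solve 2 (λ p q → p := (p :+ q) :- q) refl (a zero) (Σℚ.sum (tail a)) ⟩
        Σℚ.sum a ℚ.- Σℚ.sum (tail a)
          ≡⟨ cong₂ ℚ._-_ s (trans (sym (combination-w-zero a)) (eq zero)) ⟩
        1ℚ ℚ.- fromℤ (y zero)               ≡⟨ cong (1ℚ ℚ.+_) (fromℤ-neg (y zero)) ⟨
        1ℚ ℚ.+ fromℤ (ℤ.- y zero)           ≡⟨ fromℤ-+ (+ 1) (ℤ.- y zero) ⟨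
        fromℤ z                             ∎

    barycentric : A.Carrier → Vector ℚ (suc n)
    barycentric (x , x∈) = proj₁ (Aff⊆u x∈)

    barycentric-sum : ∀ X → Σℚ.sum (barycentric X) ≡ 1ℚ
    barycentric-sum (x , x∈) = proj₁ (proj₂ (Aff⊆u x∈))

    barycentric-combination : ∀ X → combination M (barycentric X) u ≗ ι M (proj₁ X)
    barycentric-combination (x , x∈) = proj₂ (proj₂ (Aff⊆u x∈))

    barycentric-unique : ∀ X a → Σℚ.sum a ≡ 1ℚ → combination M a u ≗ ι M (proj₁ X) →
      a ≗ barycentric X
    barycentric-unique X a s eq =
      independent⇒unique M u independent (trans s (sym (barycentric-sum X)))
      (λ j → trans (eq j) (sym (barycentric-combination X j)))

    -- Here `apexIntegral` enters: it lets `toPyramid` be applied with an integer z, so that lattice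
    -- points go to lattice points.
    apexCoordinate : ∀ X → Integral (barycentric X zero)
    apexCoordinate X =
      apexIntegral (barycentric X) (proj₁ X) (barycentric-sum X) (barycentric-combination X)

    apexInteger : A.Carrier → ℤ
    apexInteger X = integer (apexCoordinate X)

    apexInteger-unique : ∀ X a z → Σℚ.sum a ≡ 1ℚ → combination M a u ≗ ι M (proj₁ X) →
      a zero ≡ fromℤ z → apexInteger X ≡ z
    apexInteger-unique X a z s eq a₀ = fromℤ-injective (apexInteger X) z
      (trans (sym (equality (apexCoordinate X)))
        (trans (sym (barycentric-unique X a s eq zero)) a₀))

    to : A.Carrier → A′.Carrier
    to X = toPyramid (apexInteger X) (proj₁ X) , barycentric X , barycentric-sum X ,
      combination-toPyramid (barycentric X) (apexInteger X)
        (proj₁ X) (barycentric-sum X) (equality (apexCoordinate X)) (barycentric-combination X)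

    from : A′.Carrier → A.Carrier
    from (y , a , s , eq) = fromPyramid y , u⊆Aff (a , s , proj₂ (combination-fromPyramid a y s eq))

    to-combination : ∀ X a → Σℚ.sum a ≡ 1ℚ → combination M a u ≗ ι M (proj₁ X) →
      combination M′ a w ≗ ι M′ (proj₁ (to X))
    to-combination X a s eq = combination-toPyramid a (apexInteger X) (proj₁ X) s
      (trans (barycentric-unique X a s eq zero) (equality (apexCoordinate X))) eq

    -- Equal points may carry different proofs of lying in the affine hull, and `to` reads its
    -- coefficients off that proof. Uniqueness of barycentric coordinates reconciles them.
    to-cong : ∀ {X X′} → X A.≈ X′ → to X A′.≈ to X′
    to-cong {X} {X′} X≈X′ j = fromℤ-injective _ _ (trans
      (sym (to-combination X (barycentric X) (barycentric-sum X) (barycentric-combination X) j))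
      (to-combination X′ (barycentric X) (barycentric-sum X)
        (λ l → trans (barycentric-combination X l) (ι-cong M X≈X′ l)) j))

    from-cong : ∀ {Y Y′} → Y A′.≈ Y′ → from Y A.≈ from Y′
    from-cong {Y} {Y′} Y≈Y′ = ι-injective M λ j → cong fromℤ (trans (coord-fromCoord M _ j) (trans
      (cong₂ (λ y₀ y → y ℤ.+ (+ 1 ℤ.- y₀) ℤ.* coord (u zero) j) (Y≈Y′ zero) (Y≈Y′ (suc j)))
      (sym (coord-fromCoord M _ j))))

    -- The coefficients stored in Y also represent `from Y`, so the apex integer there is 1 - y₀,
    -- the very z that `fromPyramid` used.
    to-from : ∀ Y → to (from Y) A′.≈ Y
    to-from Y@(y , a , s , eq) j = trans
      (cong (λ z → toPyramid z (fromPyramid y) j)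
        (apexInteger-unique (from Y) a (+ 1 ℤ.- y zero) s
          (proj₂ (combination-fromPyramid a y s eq)) (proj₁ (combination-fromPyramid a y s eq))))
      (toPyramid-fromPyramid y j)

    from-to : ∀ X → from (to X) A.≈ X
    from-to X = ι-injective M λ j → trans
      (sym (proj₂ (combination-fromPyramid (barycentric X) (proj₁ (to X)) (barycentric-sum X)
        (proj₂ (proj₂ (proj₂ (to X))))) j))
      (barycentric-combination X j)

    bijection : Inverse (AffineLattice P) (AffineLattice P′)
    bijection = record
      { to        = to
      ; from      = from
      ; to-cong   = λ {X} {X′} → to-cong {X} {X′}
      ; from-cong = λ {Y} {Y′} → from-cong {Y} {Y′}
      ; inverse   =
        (λ {Y} {X} X≈ → A′.trans {to X} {to (from Y)} {Y} (to-cong {X} {from Y} X≈) (to-from Y)) ,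
                    (λ {X} {Y} Y≈ → A.trans {from Y} {from (to X)} {X} (from-cong {Y} {to X} Y≈)
                      (from-to X))
      }

    -- The combination d of the barycentric vectors with weights aᵢ has sum 1 and represents Y; by
    -- uniqueness its apex entry is that of Y.
    apexInteger-affine : ∀ {m} (a : Vector ℤ m) (X : Vector A.Carrier m) Y → Σℤ.sum a ≡ + 1 →
      (∀ j → Σℤ.sum (λ i → a i ℤ.* coord (proj₁ (X i)) j) ≡ coord (proj₁ Y) j) →
      Σℤ.sum (λ i → a i ℤ.* apexInteger (X i)) ≡ apexInteger Y
    apexInteger-affine {m} a X Y s eq = sym (apexInteger-unique Y d
      (Σℤ.sum (λ i → a i ℤ.* apexInteger (X i))) d-sum d-combination d₀)
      where
      open ≡-Reasoning
      d : Vector ℚ (suc n)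
      d l = Σℚ.sum (λ i → fromℤ (a i) ℚ.* barycentric (X i) l)
      d-sum : Σℚ.sum d ≡ 1ℚ
      d-sum = begin
        Σℚ.sum d
          ≡⟨ Σℚ.∑-comm (λ l i → fromℤ (a i) ℚ.* barycentric (X i) l) ⟩
        Σℚ.sum (λ i → Σℚ.sum (λ l → fromℤ (a i) ℚ.* barycentric (X i) l))
          ≡⟨ Σℚ.sum-cong-≗ (λ i → trans (sym (*-distribˡ-sum (fromℤ (a i)) (barycentric (X i))))
               (trans (cong (fromℤ (a i) ℚ.*_) (barycentric-sum (X i)))
                 (ℚ.*-identityʳ (fromℤ (a i))))) ⟩
        Σℚ.sum (λ i → fromℤ (a i))
          ≡⟨ fromℤ-sum a ⟨
        fromℤ (Σℤ.sum a)
          ≡⟨ cong fromℤ s ⟩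
        1ℚ ∎
      d-combination : combination M d u ≗ ι M (proj₁ Y)
      d-combination j = begin
        Σℚ.sum (λ l → d l ℚ.* ι M (u l) j)
          ≡⟨ Σℚ.sum-cong-≗
            (λ l → *-distribʳ-sum (ι M (u l) j) (λ i → fromℤ (a i) ℚ.* barycentric (X i) l)) ⟩
        Σℚ.sum (λ l → Σℚ.sum (λ i → fromℤ (a i) ℚ.* barycentric (X i) l ℚ.* ι M (u l) j))
          ≡⟨ Σℚ.∑-comm (λ l i → fromℤ (a i) ℚ.* barycentric (X i) l ℚ.* ι M (u l) j) ⟩
        Σℚ.sum (λ i → Σℚ.sum (λ l → fromℤ (a i) ℚ.* barycentric (X i) l ℚ.* ι M (u l) j))
          ≡⟨ Σℚ.sum-cong-≗ (λ i → trans (combination-* M (fromℤ (a i)) (barycentric (X i)) u j)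
               (cong (fromℤ (a i) ℚ.*_) (barycentric-combination (X i) j))) ⟩
        Σℚ.sum (λ i → fromℤ (a i) ℚ.* ι M (proj₁ (X i)) j)
          ≡⟨ Σℚ.sum-cong-≗ (λ i → fromℤ-* (a i) (coord (proj₁ (X i)) j)) ⟨
        Σℚ.sum (λ i → fromℤ (a i ℤ.* coord (proj₁ (X i)) j))
          ≡⟨ fromℤ-sum (λ i → a i ℤ.* coord (proj₁ (X i)) j) ⟨
        fromℤ (Σℤ.sum (λ i → a i ℤ.* coord (proj₁ (X i)) j))
          ≡⟨ cong fromℤ (eq j) ⟩
        ι M (proj₁ Y) j ∎
      d₀ : d zero ≡ fromℤ (Σℤ.sum (λ i → a i ℤ.* apexInteger (X i)))
      d₀ = trans
        (Σℚ.sum-cong-≗ (λ i → trans (cong (fromℤ (a i) ℚ.*_) (equality (apexCoordinate (X i))))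
          (sym (fromℤ-* (a i) (apexInteger (X i))))))
        (sym (fromℤ-sum (λ i → a i ℤ.* apexInteger (X i))))

    -- Every coordinate of `toPyramid` has the form x - z t: with x = t = 1 in the first, and with t
    -- a coordinate of the apex in the others.
    sum-linear : ∀ {m} (a x z : Vector ℤ m) t →
      Σℤ.sum (λ i → a i ℤ.* (x i ℤ.- z i ℤ.* t)) ≡ Σℤ.sum
        (λ i → a i ℤ.* x i) ℤ.- Σℤ.sum (λ i → a i ℤ.* z i) ℤ.* t
    sum-linear {0}     a x z t = solve 1 (λ t → con (+ 0) := con (+ 0) :- con (+ 0) :* t) refl t
      where open ℤ-Solver
    sum-linear {suc m} a x z t = trans (cong (λ s → a zero ℤ.* (x zero ℤ.- z zero ℤ.* t) ℤ.+ s)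
      (sum-linear (tail a) (tail x) (tail z) t))
      (solve 6 (λ a x z t p q → a :* (x :- z :* t) :+ (p :- q :* t) := (a :* x :+ p) :-
        (a :* z :+ q) :* t) refl
        (a zero) (x zero) (z zero) t
          (Σℤ.sum (λ i → a (suc i) ℤ.* x (suc i))) (Σℤ.sum (λ i → a (suc i) ℤ.* z (suc i))))
      where open ℤ-Solver

    affine : IsAffine P P′ to
    affine a X Y s eq zero = begin
      Σℤ.sum (λ i → a i ℤ.* (+ 1 ℤ.- apexInteger (X i)))
        ≡⟨ Σℤ.sum-cong-≗
          (λ i → cong (λ z → a i ℤ.* (+ 1 ℤ.- z)) (sym (ℤ.*-identityʳ (apexInteger (X i))))) ⟩
      Σℤ.sum (λ i → a i ℤ.* (+ 1 ℤ.- apexInteger (X i) ℤ.* + 1))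
        ≡⟨ sum-linear a (λ _ → + 1) (λ i → apexInteger (X i)) (+ 1) ⟩
      Σℤ.sum (λ i → a i ℤ.* + 1) ℤ.- Σℤ.sum (λ i → a i ℤ.* apexInteger (X i)) ℤ.* + 1
        ≡⟨ cong₂ ℤ._-_ (trans (Σℤ.sum-cong-≗ (λ i → ℤ.*-identityʳ (a i))) s)
             (trans (ℤ.*-identityʳ _) (apexInteger-affine a X Y s eq)) ⟩
      + 1 ℤ.- apexInteger Y ∎
      where open ≡-Reasoning
    affine a X Y s eq (suc j) = trans
      (sum-linear a (λ i → coord (proj₁ (X i)) j) (λ i → apexInteger (X i)) (coord (u zero) j))
      (cong₂ (λ p q → p ℤ.- q ℤ.* coord (u zero) j) (eq j) (apexInteger-affine a X Y s eq))

    isVertex-to : ∀ X → IsVertex P (proj₁ X) → IsVertex P′ (proj₁ (to X))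
    isVertex-to X vertex = isVertex-transfer M M′ u w independent independent-w
      (barycentric X) (proj₁ X) (proj₁ (to X))
      (barycentric-sum X) (barycentric-combination X) (proj₂ (proj₂ (proj₂ (to X))))
      (isVertex-resp P (conv u) P⊆u u⊆P (proj₁ X) vertex)

    isVertex-from : ∀ Y → IsVertex P′ (proj₁ Y) → IsVertex P (proj₁ (from Y))
    isVertex-from Y@(y , a , s , eq) vertex = isVertex-resp (conv u) P u⊆P P⊆u (fromPyramid y)
      (isVertex-transfer M′ M w u independent-w independent a y (fromPyramid y)
        s eq (proj₂ (combination-fromPyramid a y s eq)) vertex)

    iso : Isomorphism P P′
    iso = record
      { bijection = bijection
      ; affine    = affine
      ; vertices  = isVertex-to , λ Y vertex → from Y , isVertex-from Y vertex , to-from Y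
      }

    facet : LatticePolytope M
    facet = conv (tail u)

    facet′ : LatticePolytope M′
    facet′ = copyOfBase 1 base

    -- Points of the facet have apex coefficient 0. Prefixing 0 turns facet coefficients into
    -- coefficients over `u`, which `to` preserves.
    isVertex-facet-to : ∀ X → IsVertex facet (proj₁ X) → IsVertex facet′ (proj₁ (to X))
    isVertex-facet-to X@(x , _) vertex@((a , _ , s , eq) , _) =
      isVertex-transfer M M′ (tail u) (tail w) (independent-tail M u independent)
        (independent-tail M′ w independent-w) a x (proj₁ (to X))
        s eq (λ j → trans (sym (combination-0∷ M′ a w j)) (to-combination X (0ℚ ∷ᵛ a)
          (trans (ℚ.+-identityˡ (Σℚ.sum a)) s) (λ l → trans (combination-0∷ M a u l) (eq l)) j))
        vertex

    isVertex-facet-from : ∀ Y → IsVertex facet′ (proj₁ Y) → IsVertex facet (proj₁ (from Y))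
    isVertex-facet-from Y@(y , _) vertex@((a , _ , s , eq) , _) =
      isVertex-transfer M′ M (tail w) (tail u) (independent-tail M′ w independent-w)
        (independent-tail M u independent) a y (fromPyramid y)
        s eq (λ j → trans (sym (combination-0∷ M a u j)) (proj₂ (combination-fromPyramid (0ℚ ∷ᵛ a) y
          (trans (ℚ.+-identityˡ (Σℚ.sum a)) s) (λ l → trans (combination-0∷ M′ a w l) (eq l))) j))
        vertex

    facet⊆P : Points facet ⊆ Points P
    facet⊆P (a , 0≤a , s , eq) = u⊆P (0ℚ ∷ᵛ a , (λ { zero → ℚ.≤-refl ; (suc i) → 0≤a i }) ,
      trans (ℚ.+-identityˡ (Σℚ.sum a)) s , λ j → trans (combination-0∷ M a u j) (eq j))

  oppositeFacet : LatticeSimplex M n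
  oppositeFacet = record { vertices = tail u ; independent = independent-tail M u independent }

  -- For n = 0 the facet is the empty simplex of dimension -1 and P is a single lattice point, so
  -- the height l = 1 is right in this case too.
  isLatticePyramidOver : IsLatticePyramidOver P (LatticeSimplex.polytope oppositeFacet)
  isLatticePyramidOver = record
    { Q⊆P         = facet⊆P
    ; dimP        = + suc n ℤ.- + 1
    ; dimQ        = + n ℤ.- + 1
    ; dim-P       = suc n , u , independent , (λ i → u⊆P (generator∈convexHull M u i)) ,
                    (λ i → Aff⊆u (convexHull⊆affineHull M (generator∈convexHull M _ i))) , refl
    ; dim-Q       =
      n , tail u , independent-tail M u independent , generator∈convexHull M (tail u) ,
                    (λ i → convexHull⊆affineHull M (generator∈convexHull M (tail u) i)) , refl
    ; l           = 1
    ; l≡dimP-dimQ =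
      solve 1 (λ n → con (+ 1) := (con (+ 1) :+ n :- con (+ 1)) :- (n :- con (+ 1))) refl (+ n)
    ; k           = rank
    ; B           = base
    ; iso         = iso
    ; Q↦B         =
      isVertex-facet-to , λ Y vertex → from Y , isVertex-facet-from Y vertex , to-from Y
    }
    where open ℤ-Solver

-- Moving the apex to the front of the list of vertices.

module _ {n} (p : Fin (suc n)) where

  -- `pyramid` lists the apex first, whereas the integral coordinate p may be anywhere; vertices and
  -- coefficients are reordered alike.
  bringToFront : ∀ {A : Set c} → Vector A (suc n) → Vector A (suc n)
  bringToFront a = a p ∷ᵛ removeAt a p

  sendBack : Vector ℚ (suc n) → Vector ℚ (suc n)
  sendBack a = insertAt (tail a) p (head a)

  bringToFront-sendBack : ∀ a → bringToFront (sendBack a) ≗ a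
  bringToFront-sendBack a zero    = insertAt-lookup (tail a) p (head a)
  bringToFront-sendBack a (suc i) = removeAt-insertAt (tail a) p (head a) i

  sum-bringToFront : ∀ a → Σℚ.sum (bringToFront a) ≡ Σℚ.sum a
  sum-bringToFront a = sym (Σℚ.sum-remove {i = p} a)

all-bringToFront⁺ : ∀ {n} p (Q : ℚ → Set) (a : Vector ℚ (suc n)) → (∀ i → Q (a i)) → ∀ i →
  Q (bringToFront p a i)
all-bringToFront⁺ p Q a h zero    = h p
all-bringToFront⁺ p Q a h (suc i) = h (punchIn p i)

all-bringToFront⁻ : ∀ {n} p (Q : ℚ → Set) (a : Vector ℚ (suc n)) →
  (∀ i → Q (bringToFront p a i)) → ∀ i → Q (a i)
all-bringToFront⁻ p Q a h i with p Fin.≟ i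
-- Every index is either p or the image under `punchIn p` of an index of the tail.
... | yes refl = h zero
... | no p≢i   = subst (Q ∘ a) (punchIn-punchOut p≢i) (h (suc (punchOut p≢i)))

module _ (M : Lattice c ℓ) {n} (v : Vector (Lattice.Carrier M) (suc n)) (p : Fin (suc n)) where
  private
    u : Vector (Lattice.Carrier M) (suc n)
    u = bringToFront p v

  combination-bringToFront : ∀ a → combination M (bringToFront p a) u ≗ combination M a v
  combination-bringToFront a j = sum-bringToFront p (λ i → a i ℚ.* ι M (v i) j)

  sum-sendBack : ∀ a → Σℚ.sum (sendBack p a) ≡ Σℚ.sum a
  sum-sendBack a =
    trans (sym (sum-bringToFront p (sendBack p a))) (Σℚ.sum-cong-≗ (bringToFront-sendBack p a))

  combination-sendBack : ∀ a → combination M (sendBack p a) v ≗ combination M a u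
  combination-sendBack a j = trans (sym (combination-bringToFront (sendBack p a) j))
    (combination-cong M u (bringToFront-sendBack p a) j)

  independent-bringToFront : AffinelyIndependent M v → AffinelyIndependent M u
  independent-bringToFront ind a s eq i = trans (sym (bringToFront-sendBack p a i))
    (all-bringToFront⁺ p (_≡ 0ℚ) (sendBack p a)
      (ind (sendBack p a) (trans (sum-sendBack a) s)
        (λ j → trans (combination-sendBack a j) (eq j))) i)

  affineHull-bringToFront⁺ : AffineHull M v ⊆ AffineHull M u
  affineHull-bringToFront⁺ (a , s , eq) = bringToFront p a , trans (sum-bringToFront p a) s ,
    λ j → trans (combination-bringToFront a j) (eq j)

  affineHull-bringToFront⁻ : AffineHull M u ⊆ AffineHull M v
  affineHull-bringToFront⁻ (a , s , eq) = sendBack p a , trans (sum-sendBack a) s ,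
    λ j → trans (combination-sendBack a j) (eq j)

  convexHull-bringToFront⁺ : ConvexHull M v ⊆ ConvexHull M u
  convexHull-bringToFront⁺ (a , 0≤a , s , eq) =
    bringToFront p a , all-bringToFront⁺ p (0ℚ ℚ.≤_) a 0≤a ,
    trans (sum-bringToFront p a) s , λ j → trans (combination-bringToFront a j) (eq j)

  convexHull-bringToFront⁻ : ConvexHull M u ⊆ ConvexHull M v
  convexHull-bringToFront⁻ (a , 0≤a , s , eq) = sendBack p a ,
    all-bringToFront⁻ p (0ℚ ℚ.≤_)
      (sendBack p a) (λ i → subst (0ℚ ℚ.≤_) (sym (bringToFront-sendBack p a i)) (0≤a i)) ,
    trans (sum-sendBack a) s , λ j → trans (combination-sendBack a j) (eq j)

theorem2p1 : {c ℓ : Level} (M : Lattice c ℓ) (d n : ℕ)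
    (P : LatticeSimplex M (suc n)) (e : ℕ) →
    HasDegree n (LatticeSimplex.polytope P) e → e ≤ d →
    4 * d ≤ n + 1 →
    Σ (LatticeSimplex M n) (λ Q →
    IsLatticePyramidOver (LatticeSimplex.polytope P) (LatticeSimplex.polytope Q))
theorem2p1 M d n P e degree e≤d 4d≤n+1
  with integralCoordinate M (LatticeSimplex.vertices P) (LatticeSimplex.independent P) degree
         -- The degree e itself satisfies 4e ≤ 4d ≤ n + 1, the bound in terms of the number of
         -- vertices.
         (ℕ.≤-trans (ℕ.*-monoʳ-≤ 4 e≤d) (ℕ.≤-trans 4d≤n+1 (ℕ.≤-reflexive (ℕ.+-comm n 1))))
... | p , int = Pyramid.oppositeFacet , Pyramid.isLatticePyramidOver
  where
  v = LatticeSimplex.vertices P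
  apexIntegral : ∀ a x → Σℚ.sum a ≡ 1ℚ → combination M a (bringToFront p v) ≗ ι M x →
    Integral (a zero)
  -- Lattice points of the affine hull sit at height 1 in M ⊕ ℤ, hence the integer `+ 1`. The entry
  -- of `sendBack p a` at p is the first entry of a.
  apexIntegral a x s eq = subst Integral (bringToFront-sendBack p a zero) (int {sendBack p a}
    (integral (+ 1) (trans (sum-sendBack M v p a) s) ,
     λ j → integral (Lattice.coord M x j) (trans (combination-sendBack M v p a j) (eq j))))
  module Pyramid = LatticePyramid M (LatticeSimplex.polytope P) (bringToFront p v)
    (independent-bringToFront M v p (LatticeSimplex.independent P))
    (convexHull-bringToFront⁺ M v p) (convexHull-bringToFront⁻ M v p)
    (affineHull-bringToFront⁺ M v p) (affineHull-bringToFront⁻ M v p)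
    apexIntegral
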